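{- There is an absolute constant $K>0$ such that for every $n\ge 1$ and every $f:\{0,1\}^n\to\{0,1\}$, $$\mathrm{EC}(f)\le K\cdot \mathrm{FC}(f)^{3/2}\quad\text{and}\quad \mathrm{EC}(f)\le K\cdot R(f)^{3/2},$$ and moreover $\mathrm{FC}(f)^{3/2}\le K\cdot R(f)^{3/2}$; that is, $\mathrm{EC}(f)=O(\mathrm{FC}(f)^{3/2})=O(R(f)^{3/2})$.
   Context: Let $f:\{0,1\}^n\to\{0,1\}$ and $[n]=\{1,\dots,n\}$. The expectational certificate complexity $\mathrm{EC}(f)$ is the optimal value of the following program over families $\{w_x\}_{x\in\{0,1\}^n}$, $w_x\in\mathbb R^n$: minimize $\max_{x}\sum_{i=1}^n w_x(i)$ subject to $\sum_{i:x_i\ne y_i} w_x(i)w_y(i)\ge 1$ for all $x,y$ with $f(x)\ne f(y)$, and $0\le w_x(i)\le 1$ for all $x\in\{0,1\}^n$, $i\in[n]$. Fractional certificate complexity: for $x\in\{0,1\}^n$, $\mathrm{FC}(f,x)$ is the optimal value of the linear program: minimize $\sum_{i\in[n]}v_x(i)$ over $v_x\in\mathbb R^n$ with $v_x(i)\ge 0$ for all $i$, subject to $\sum_{i:x_i\ne y_i}v_x(i)\ge 1$ for all $y$ with $f(y)\ne f(x)$. $\mathrm{FC}(f)=\max_{x}\mathrm{FC}(f,x)$. Randomized query complexity: a randomized query algorithm $\mathcal A$ is given query access to $x\in\{0,1\}^n$ and a random string $r$; with one query it learns one bit $x_i$ of its choice (adaptively), and finally outputs a bit $\mathcal A(x,r)$.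 (Equivalently, it is a probability distribution over deterministic decision trees.) Its worst-case complexity is the maximum over $x$ and $r$ of the number of queries made. $R(f)$ is the minimum worst-case complexity of a randomized query algorithm $\mathcal A$ with $\Pr_r[\mathcal A(x,r)\ne f(x)]\le 1/3$ for every $x\in\{0,1\}^n$. -}

module Defs where

open import Data.Bool.Base using (Bool; true; false; if_then_else_)
open import Data.Bool.Properties using (_≟_)
open import Data.Fin.Base using (Fin)
open import Data.Integer.Base using (+_)
open import Data.Nat.Base as ℕ using (ℕ; zero; suc)
import Data.Nat.Properties as ℕ
open import Data.Product.Base using (Σ; ∃; Σ-syntax; ∃-syntax; _×_; _,_)
open import Data.Rational.Base as ℚ using (ℚ; 0ℚ; 1ℚ; ½; ∣_∣)
import Data.Rational.Properties as ℚ
open import Data.Rational.Solver using (module +-*-Solver)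
open import Data.Sum.Base using (inj₁; inj₂)
open import Data.Vec.Base using (Vec; []; _∷_; lookup)
open import Data.Vec.Functional using (Vector; foldr)
open import Function.Base using (_∘_)
open import Relation.Binary.PropositionalEquality
  using (_≡_; _≢_; refl; sym; trans; cong; subst; subst₂)
open import Relation.Nullary.Decidable.Core using (does)

------------------------------------------------------------------------
-- Real numbers as Cauchy sequences of rationals

IsCauchy : (ℕ → ℚ) → Set
IsCauchy s = ∀ ε → 0ℚ ℚ.< ε →
  ∃[ N ] (∀ m n → N ℕ.≤ m → N ℕ.≤ n → ∣ s m ℚ.- s n ∣ ℚ.< ε)

record ℝ : Set where
  constructor mkℝ
  field
    seq    : ℕ → ℚ
    cauchy : IsCauchy seq

open ℝ public

infix  4 _≤_ _<_ _≃_
infixl 6 _+_ _⊔_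
infixl 7 _*_

_≤_ : ℝ → ℝ → Set
x ≤ y = ∀ ε → 0ℚ ℚ.< ε →
  ∃[ N ] (∀ n → N ℕ.≤ n → seq x n ℚ.≤ seq y n ℚ.+ ε)

_<_ : ℝ → ℝ → Set
x < y = Σ[ ε ∈ ℚ ] (0ℚ ℚ.< ε ×
  (∃[ N ] (∀ n → N ℕ.≤ n → seq x n ℚ.+ ε ℚ.≤ seq y n)))

_≃_ : ℝ → ℝ → Set
x ≃ y = (x ≤ y) × (y ≤ x)

private
  open +-*-Solver using (solve; _:+_; _:*_; :-_; _:-_; _:=_)

  -- Abstract so that moduli are not unfolded when real numbers are compared.
  abstract
    half>0 : ∀ {ε} → 0ℚ ℚ.< ε → 0ℚ ℚ.< ½ ℚ.* ε
    half>0 {ε} ε>0 = subst (ℚ._< ½ ℚ.* ε) (ℚ.*-zeroʳ ½) (ℚ.*-monoʳ-<-pos ½ ε>0)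

    half+half : ∀ ε → ½ ℚ.* ε ℚ.+ ½ ℚ.* ε ≡ ε
    half+half ε = trans (sym (ℚ.*-distribʳ-+ ε ½ ½)) (ℚ.*-identityˡ ε)

    p≤∣p∣ : ∀ p → p ℚ.≤ ∣ p ∣
    p≤∣p∣ p with ℚ.≤-total 0ℚ p
    ... | inj₁ 0≤p = ℚ.≤-reflexive (sym (ℚ.0≤p⇒∣p∣≡p 0≤p))
    ... | inj₂ p≤0 = ℚ.≤-trans p≤0 (ℚ.0≤∣p∣ p)

    ∣p∣≤∣q∣+∣p-q∣ : ∀ p q → ∣ p ∣ ℚ.≤ ∣ q ∣ ℚ.+ ∣ p ℚ.- q ∣
    ∣p∣≤∣q∣+∣p-q∣ p q = subst (λ z → ∣ z ∣ ℚ.≤ ∣ q ∣ ℚ.+ ∣ p ℚ.- q ∣)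
      (solve 2 (λ a b → b :+ (a :- b) := a) refl p q)
      (ℚ.∣p+q∣≤∣p∣+∣q∣ q (p ℚ.- q))

    p-q<ε⇒p<q+ε : ∀ p q {ε} → ∣ p ℚ.- q ∣ ℚ.< ε → p ℚ.< q ℚ.+ ε
    p-q<ε⇒p<q+ε p q {ε} d = subst (ℚ._< q ℚ.+ ε)
      (solve 2 (λ a b → b :+ (a :- b) := a) refl p q)
      (ℚ.+-monoʳ-< q (ℚ.≤-<-trans (p≤∣p∣ (p ℚ.- q)) d))

    q<p+ε⇒q-p<ε : ∀ p q {ε} → q ℚ.< p ℚ.+ ε → q ℚ.- p ℚ.< ε
    q<p+ε⇒q-p<ε p q {ε} lt = subst (q ℚ.- p ℚ.<_)
      (solve 2 (λ a e → (a :+ e) :- a := e) refl p ε)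
      (ℚ.+-monoˡ-< (ℚ.- p) lt)

    ∣p-q∣<ε : ∀ p q {ε} → p ℚ.< q ℚ.+ ε → q ℚ.< p ℚ.+ ε → ∣ p ℚ.- q ∣ ℚ.< ε
    ∣p-q∣<ε p q {ε} lt₁ lt₂ with ℚ.∣p∣≡p∨∣p∣≡-p (p ℚ.- q)
    ... | inj₁ eq = subst (ℚ._< ε) (sym eq) (q<p+ε⇒q-p<ε q p lt₁)
    ... | inj₂ eq = subst (ℚ._< ε)
      (sym (trans eq (solve 2 (λ a b → :- (a :- b) := b :- a) refl p q)))
      (q<p+ε⇒q-p<ε p q lt₂)

    ⊔<⊔+ε : ∀ a b c d {ε} → a ℚ.< c ℚ.+ ε → b ℚ.< d ℚ.+ ε →
            a ℚ.⊔ b ℚ.< (c ℚ.⊔ d) ℚ.+ ε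
    ⊔<⊔+ε a b c d {ε} a< b< with ℚ.⊔-sel a b
    ... | inj₁ eq rewrite eq = ℚ.<-≤-trans a< (ℚ.+-monoˡ-≤ ε (ℚ.p≤p⊔q c d))
    ... | inj₂ eq rewrite eq = ℚ.<-≤-trans b< (ℚ.+-monoˡ-≤ ε (ℚ.p≤q⊔p c d))

    bounded : ∀ s → IsCauchy s →
              Σ[ B ∈ ℚ ] (0ℚ ℚ.< B × (∃[ N ] (∀ n → N ℕ.≤ n → ∣ s n ∣ ℚ.≤ B)))
    bounded s c with N , close ← c 1ℚ (ℚ.positive⁻¹ 1ℚ) =
      ∣ s N ∣ ℚ.+ 1ℚ ,
      ℚ.+-mono-≤-< (ℚ.0≤∣p∣ (s N)) (ℚ.positive⁻¹ 1ℚ) ,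
      N , λ n N≤n → ℚ.≤-trans (∣p∣≤∣q∣+∣p-q∣ (s n) (s N))
        (ℚ.+-monoʳ-≤ ∣ s N ∣ (ℚ.<⇒≤ (close n N N≤n ℕ.≤-refl)))

    +-cauchy : ∀ s t → IsCauchy s → IsCauchy t → IsCauchy (λ n → s n ℚ.+ t n)
    +-cauchy s t cs ct ε ε>0
      with M , s-close ← cs (½ ℚ.* ε) (half>0 ε>0)
         | N , t-close ← ct (½ ℚ.* ε) (half>0 ε>0) =
      M ℕ.⊔ N , λ m n ≤m ≤n → subst (∣ (s m ℚ.+ t m) ℚ.- (s n ℚ.+ t n) ∣ ℚ.<_)
        (half+half ε)
        (ℚ.≤-<-trans
          (subst (λ z → ∣ z ∣ ℚ.≤ ∣ s m ℚ.- s n ∣ ℚ.+ ∣ t m ℚ.- t n ∣)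
            (solve 4 (λ a b c d → (a :- b) :+ (c :- d) := (a :+ c) :- (b :+ d))
              refl (s m) (s n) (t m) (t n))
            (ℚ.∣p+q∣≤∣p∣+∣q∣ (s m ℚ.- s n) (t m ℚ.- t n)))
          (ℚ.+-mono-<
            (s-close m n (ℕ.m⊔n≤o⇒m≤o M N ≤m) (ℕ.m⊔n≤o⇒m≤o M N ≤n))
            (t-close m n (ℕ.m⊔n≤o⇒n≤o M N ≤m) (ℕ.m⊔n≤o⇒n≤o M N ≤n))))

    ⊔-cauchy : ∀ s t → IsCauchy s → IsCauchy t → IsCauchy (λ n → s n ℚ.⊔ t n)
    ⊔-cauchy s t cs ct ε ε>0
      with M , s-close ← cs ε ε>0
         | N , t-close ← ct ε ε>0 =
      M ℕ.⊔ N , λ m n ≤m ≤n → ∣p-q∣<ε (s m ℚ.⊔ t m) (s n ℚ.⊔ t n)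
        (below m n ≤m ≤n) (below n m ≤n ≤m)
      where
      below : ∀ m n → M ℕ.⊔ N ℕ.≤ m → M ℕ.⊔ N ℕ.≤ n →
              s m ℚ.⊔ t m ℚ.< (s n ℚ.⊔ t n) ℚ.+ ε
      below m n ≤m ≤n = ⊔<⊔+ε (s m) (t m) (s n) (t n)
        (p-q<ε⇒p<q+ε (s m) (s n)
          (s-close m n (ℕ.m⊔n≤o⇒m≤o M N ≤m) (ℕ.m⊔n≤o⇒m≤o M N ≤n)))
        (p-q<ε⇒p<q+ε (t m) (t n)
          (t-close m n (ℕ.m⊔n≤o⇒n≤o M N ≤m) (ℕ.m⊔n≤o⇒n≤o M N ≤n)))

    scaled< : ∀ p q {A δ} → 0ℚ ℚ.< A → ∣ p ∣ ℚ.≤ A → ∣ q ∣ ℚ.< δ →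
              ∣ p ℚ.* q ∣ ℚ.< A ℚ.* δ
    scaled< p q {A} {δ} A>0 p≤A q<δ = subst (ℚ._< A ℚ.* δ) (sym (ℚ.∣p*q∣≡∣p∣*∣q∣ p q))
      (ℚ.≤-<-trans
        (ℚ.*-monoʳ-≤-nonNeg ∣ q ∣ {{ℚ.nonNegative (ℚ.0≤∣p∣ q)}} p≤A)
        (ℚ.*-monoʳ-<-pos A {{ℚ.positive A>0}} q<δ))

    divide : ∀ {C ε} → 0ℚ ℚ.< C → 0ℚ ℚ.< ε →
             Σ[ δ ∈ ℚ ] (0ℚ ℚ.< δ × C ℚ.* δ ≡ ε)
    divide {C} {ε} C>0 ε>0 =
      ℚ.1/ C ℚ.* ε ,
      ℚ.positive⁻¹ _ {{ℚ.pos*pos⇒pos (ℚ.1/ C) {{ℚ.1/pos⇒pos C}} ε}} ,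
      trans (sym (ℚ.*-assoc C (ℚ.1/ C) ε))
        (trans (cong (ℚ._* ε) (ℚ.*-inverseʳ C)) (ℚ.*-identityˡ ε))
      where
      instance
        C-pos : ℚ.Positive C
        C-pos = ℚ.positive C>0
        ε-pos : ℚ.Positive ε
        ε-pos = ℚ.positive ε>0
        C-nonZero : ℚ.NonZero C
        C-nonZero = ℚ.pos⇒nonZero C

    product-close : ∀ a b c d {A B δ} → 0ℚ ℚ.< A → 0ℚ ℚ.< B →
      ∣ a ∣ ℚ.≤ A → ∣ d ∣ ℚ.≤ B → ∣ a ℚ.- b ∣ ℚ.< δ → ∣ c ℚ.- d ∣ ℚ.< δ →
      ∣ a ℚ.* c ℚ.- b ℚ.* d ∣ ℚ.< (A ℚ.+ B) ℚ.* δ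
    product-close a b c d {A} {B} {δ} A>0 B>0 a≤A d≤B a-b c-d =
      subst₂ (λ y z → ∣ y ∣ ℚ.< z) difference (sym (ℚ.*-distribʳ-+ δ A B))
        (ℚ.≤-<-trans
          (ℚ.∣p+q∣≤∣p∣+∣q∣ (a ℚ.* (c ℚ.- d)) (d ℚ.* (a ℚ.- b)))
          (ℚ.+-mono-< (scaled< a (c ℚ.- d) A>0 a≤A c-d)
                      (scaled< d (a ℚ.- b) B>0 d≤B a-b)))
      where
      difference : a ℚ.* (c ℚ.- d) ℚ.+ d ℚ.* (a ℚ.- b) ≡ a ℚ.* c ℚ.- b ℚ.* d
      difference = solve 4
        (λ a b c d → a :* (c :- d) :+ d :* (a :- b) := a :* c :- b :* d) refl a b c d

    *-cauchy : ∀ s t → IsCauchy s → IsCauchy t → IsCauchy (λ n → s n ℚ.* t n)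
    *-cauchy s t cs ct ε ε>0 =
      let A , A>0 , N₁ , s≤A = bounded s cs
          B , B>0 , N₂ , t≤B = bounded t ct
          δ , δ>0 , Cδ≡ε     = divide (ℚ.+-mono-< A>0 B>0) ε>0
          M , s-close        = cs δ δ>0
          N , t-close        = ct δ δ>0
      in (N₁ ℕ.⊔ N₂) ℕ.⊔ (M ℕ.⊔ N) , λ m n ≤m ≤n →
        let N₁₂≤m = ℕ.m⊔n≤o⇒m≤o (N₁ ℕ.⊔ N₂) (M ℕ.⊔ N) ≤m
            N₁₂≤n = ℕ.m⊔n≤o⇒m≤o (N₁ ℕ.⊔ N₂) (M ℕ.⊔ N) ≤n
            MN≤m  = ℕ.m⊔n≤o⇒n≤o (N₁ ℕ.⊔ N₂) (M ℕ.⊔ N) ≤m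
            MN≤n  = ℕ.m⊔n≤o⇒n≤o (N₁ ℕ.⊔ N₂) (M ℕ.⊔ N) ≤n
        in subst (∣ s m ℚ.* t m ℚ.- s n ℚ.* t n ∣ ℚ.<_) Cδ≡ε
          (product-close (s m) (s n) (t m) (t n) A>0 B>0
            (s≤A m (ℕ.m⊔n≤o⇒m≤o N₁ N₂ N₁₂≤m))
            (t≤B n (ℕ.m⊔n≤o⇒n≤o N₁ N₂ N₁₂≤n))
            (s-close m n (ℕ.m⊔n≤o⇒m≤o M N MN≤m) (ℕ.m⊔n≤o⇒m≤o M N MN≤n))
            (t-close m n (ℕ.m⊔n≤o⇒n≤o M N MN≤m) (ℕ.m⊔n≤o⇒n≤o M N MN≤n)))

    const-cauchy : ∀ q → IsCauchy (λ _ → q)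
    const-cauchy q ε ε>0 =
      0 , λ _ _ _ _ → subst (λ z → ∣ z ∣ ℚ.< ε) (sym (ℚ.+-inverseʳ q)) ε>0

fromℚ : ℚ → ℝ
fromℚ q = mkℝ (λ _ → q) (const-cauchy q)

fromℕ : ℕ → ℝ
fromℕ n = fromℚ (+ n ℚ./ 1)

0ℝ 1ℝ ⅓ : ℝ
0ℝ = fromℚ 0ℚ
1ℝ = fromℚ 1ℚ
⅓  = fromℚ (+ 1 ℚ./ 3)

_+_ _*_ _⊔_ : ℝ → ℝ → ℝ
x + y = mkℝ (λ n → seq x n ℚ.+ seq y n) (+-cauchy (seq x) (seq y) (cauchy x) (cauchy y))
x * y = mkℝ (λ n → seq x n ℚ.* seq y n) (*-cauchy (seq x) (seq y) (cauchy x) (cauchy y))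
x ⊔ y = mkℝ (λ n → seq x n ℚ.⊔ seq y n) (⊔-cauchy (seq x) (seq y) (cauchy x) (cauchy y))

∑ : ∀ {n} → Vector ℝ n → ℝ
∑ = foldr _+_ 0ℝ

-- y = x^{3/2}, for x ≥ 0: the nonnegative square root of x³.
IsThreeHalvesPower : ℝ → ℝ → Set
IsThreeHalvesPower x y = 0ℝ ≤ y × y * y ≃ x * x * x

-- v = inf { value a | Feasible a }.
IsOptimalValue : {A : Set} (Feasible : A → Set) (value : A → ℝ) → ℝ → Set
IsOptimalValue Feasible value v =
  (∀ a → Feasible a → v ≤ value a) ×
  (∀ ε → 0ℝ < ε → ∃[ a ] (Feasible a × value a < v + ε))

------------------------------------------------------------------------
-- Boolean functions

Input : ℕ → Set
Input n = Vec Bool n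

BoolFun : ℕ → Set
BoolFun n = Input n → Bool

-- The maximum of g over {0,1}ⁿ, where _∨_ is the binary maximum.
maxOver : {A : Set} (_∨_ : A → A → A) → ∀ {n} → (Input n → A) → A
maxOver _∨_ {zero}  g = g []
maxOver _∨_ {suc n} g =
  maxOver _∨_ (g ∘ (false ∷_)) ∨ maxOver _∨_ (g ∘ (true ∷_))

-- The sum of u i over those i with xᵢ ≠ yᵢ.
∑≠ : ∀ {n} → Input n → Input n → Vector ℝ n → ℝ
∑≠ x y u = ∑ λ i → if does (lookup x i ≟ lookup y i) then 0ℝ else u i

------------------------------------------------------------------------
-- Expectational certificate complexity

record ECFeasible {n} (f : BoolFun n) (w : Input n → Vector ℝ n) : Set where
  field
    nonneg : ∀ x i → 0ℝ ≤ w x i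
    ≤one   : ∀ x i → w x i ≤ 1ℝ
    covers : ∀ x y → f x ≢ f y → 1ℝ ≤ ∑≠ x y (λ i → w x i * w y i)

IsEC : ∀ {n} → BoolFun n → ℝ → Set
IsEC f = IsOptimalValue (ECFeasible f) (λ w → maxOver _⊔_ (λ x → ∑ (w x)))

------------------------------------------------------------------------
-- Fractional certificate complexity

record FCFeasible {n} (f : BoolFun n) (x : Input n) (v : Vector ℝ n) : Set where
  field
    nonneg : ∀ i → 0ℝ ≤ v i
    covers : ∀ y → f y ≢ f x → 1ℝ ≤ ∑≠ x y v

IsFCAt : ∀ {n} → BoolFun n → Input n → ℝ → Set
IsFCAt f x = IsOptimalValue (FCFeasible f x) ∑

IsFC : ∀ {n} → BoolFun n → ℝ → Set
IsFC {n} f c = Σ[ g ∈ (Input n → ℝ) ] ((∀ x → IsFCAt f x (g x)) × c ≃ maxOver _⊔_ g)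

------------------------------------------------------------------------
-- Randomized query complexity

data DecisionTree (n : ℕ) : Set where
  leaf  : Bool → DecisionTree n
  query : Fin n → (on-false on-true : DecisionTree n) → DecisionTree n

output : ∀ {n} → DecisionTree n → Input n → Bool
output (leaf b)        x = b
output (query i t₀ t₁) x = if lookup x i then output t₁ x else output t₀ x

queries : ∀ {n} → DecisionTree n → Input n → ℕ
queries (leaf b)        x = 0
queries (query i t₀ t₁) x = suc (if lookup x i then queries t₁ x else queries t₀ x)

-- A finitely supported probability distribution over decision trees.  Finite
-- support is no restriction: only finitely many pairs of functions
-- (output t , queries t) arise from trees t making at most d queries.
record RandomizedAlgorithm (n : ℕ) : Set where
  field
    size     : ℕ
    tree     : Vector (DecisionTree n) size
    prob     : Vector ℝ size
    prob≥0   : ∀ r → 0ℝ ≤ prob r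
    prob-sum : ∑ prob ≃ 1ℝ

  worstCase : ℕ
  worstCase = foldr ℕ._⊔_ 0 λ r → maxOver ℕ._⊔_ (queries (tree r))

  errorProb : BoolFun n → Input n → ℝ
  errorProb f x = ∑ λ r → if does (output (tree r) x ≟ f x) then 0ℝ else prob r

open RandomizedAlgorithm public

Computes : ∀ {n} → RandomizedAlgorithm n → BoolFun n → Set
Computes A f = ∀ x → errorProb A f x ≤ ⅓

IsR : ∀ {n} → BoolFun n → ℕ → Set
IsR f d =
  (∃[ A ] (Computes A f × worstCase A ≡ d)) ×
  (∀ A → Computes A f → d ℕ.≤ worstCase A)

{-# OPTIONS --safe #-}

-- All weights are taken rational: near-optimal real certificates are evaluated at
-- a late index of their Cauchy sequences and slightly enlarged.
--
-- Let v_x be fractional certificates of total weight at most S.  Every input z has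
-- at most S sensitive coordinates, as v_z is at least 1 on each of them.  Hence a
-- minimal sensitive block of x has at most S elements, and after doubling v_x the
-- weights below 1/S can be discarded.  Moreover Σ_{x_i ≠ y_i} min (v_x i, v_y i) ≥ 1
-- whenever f x ≠ f y.  So w_x i ≈ √(v_x i) is feasible for EC, and w_x ≲ √S · v_x
-- because the nonzero v_x i are at least 1/S; the total is O(S^{3/2}).
--
-- The expected numbers of queries of a randomized algorithm to the coordinates
-- of x, scaled by a constant, are fractional certificates with S = O(R).
module Submission where

open import Data.Nat.Base as ℕ using (ℕ; zero; suc)
open import Data.Product.Base using (Σ-syntax; ∃-syntax; _×_; _,_; proj₁; proj₂)
open import Defs

open import Algebra.Bundles using (module CommutativeRing)
import Algebra.Properties.Semiring.Sum as Sum
open import Data.Bool.Base using (Bool; true; false; if_then_else_)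
open import Data.Bool.Properties using (_≟_; if-float)
open import Data.Fin.Base using (Fin; zero; suc)
import Data.Fin.Properties as Fin
open import Data.Integer.Base as ℤ using (+_)
import Data.Integer.Properties as ℤ
open import Data.Nat.Induction using (<-wellFounded)
import Data.Nat.Properties as ℕ
open import Data.Rational.Base as ℚ using (ℚ; 0ℚ; 1ℚ; ½)
import Data.Rational.Properties as ℚ
open import Data.Rational.Solver using (module +-*-Solver)
import Data.Rational.Unnormalised.Base as ℚᵘ
import Data.Rational.Unnormalised.Properties as ℚᵘ
open import Data.Sum.Base using (_⊎_; inj₁; inj₂)
open import Data.Vec.Base using ([]; _∷_; replicate; lookup; tabulate; _[_]≔_)
open import Data.Vec.Functional using (Vector; foldr)
open import Data.Vec.Properties using (lookup∘tabulate; lookup∘update; lookup∘update′)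
open import Function.Base using (_∘_; case_of_)
open import Induction.WellFounded using (Acc; acc)
open import Relation.Binary.PropositionalEquality
  using (_≡_; _≢_; refl; sym; trans; cong; cong₂; subst; subst₂; module ≡-Reasoning)
open import Relation.Nullary using (Dec; yes; no; does; contradiction)
open import Relation.Nullary.Decidable
  using (toWitness; toWitnessFalse; dec-true; dec-false; _×-dec_; ¬?)

open Sum (CommutativeRing.semiring ℚ.+-*-commutativeRing)
  using (sum; sum-cong-≗; sum-replicate-zero; ∑-distrib-+; ∑-comm; *-distribˡ-sum; *-distribʳ-sum)
open +-*-Solver using (solve; _:+_; _:*_; _:-_; _:=_; con)

infix 4 _≤?_


-- Rational arithmetic and approximate square roots

-- Inequalities between rationals are proved by exhibiting the difference of
-- the two sides as a nonnegative quantity.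

≤-by-difference : ∀ {p q r} → 0ℚ ℚ.≤ r → p ℚ.+ r ≡ q → p ℚ.≤ q
≤-by-difference {p} {q} {r} 0≤r refl = subst (ℚ._≤ p ℚ.+ r) (ℚ.+-identityʳ p) (ℚ.+-monoʳ-≤ p 0≤r)

p≤q⇒0≤q-p : ∀ {p q} → p ℚ.≤ q → 0ℚ ℚ.≤ q ℚ.- p
p≤q⇒0≤q-p {p} {q} p≤q = subst (ℚ._≤ q ℚ.- p) (ℚ.+-inverseʳ p) (ℚ.+-monoˡ-≤ (ℚ.- p) p≤q)

0≤p+q : ∀ {p q} → 0ℚ ℚ.≤ p → 0ℚ ℚ.≤ q → 0ℚ ℚ.≤ p ℚ.+ q
0≤p+q = ℚ.+-mono-≤

0≤p*q : ∀ {p q} → 0ℚ ℚ.≤ p → 0ℚ ℚ.≤ q → 0ℚ ℚ.≤ p ℚ.* q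
0≤p*q {p} {q} 0≤p 0≤q =
  ℚ.nonNegative⁻¹ _ {{ℚ.nonNeg*nonNeg⇒nonNeg p {{ℚ.nonNegative 0≤p}} q {{ℚ.nonNegative 0≤q}}}}

0≤p² : ∀ p → 0ℚ ℚ.≤ p ℚ.* p
0≤p² p with ℚ.≤-total 0ℚ p
... | inj₁ 0≤p = 0≤p*q 0≤p 0≤p
... | inj₂ p≤0 = ≤-by-difference (0≤p*q (p≤q⇒0≤q-p p≤0) (p≤q⇒0≤q-p p≤0))
  (solve 1 (λ p → con 0ℚ :+ (con 0ℚ :- p) :* (con 0ℚ :- p) := p :* p) refl p)

*-mono-≤ : ∀ {p q r s} → 0ℚ ℚ.≤ p → 0ℚ ℚ.≤ r → p ℚ.≤ q → r ℚ.≤ s → p ℚ.* r ℚ.≤ q ℚ.* s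
*-mono-≤ {p} {q} {r} {s} 0≤p 0≤r p≤q r≤s = ≤-by-difference
  (0≤p+q (0≤p*q (p≤q⇒0≤q-p p≤q) (ℚ.≤-trans 0≤r r≤s)) (0≤p*q 0≤p (p≤q⇒0≤q-p r≤s)))
  (solve 4 (λ p q r s → p :* r :+ ((q :- p) :* s :+ p :* (s :- r)) := q :* s) refl p q r s)

square-cancel-≤ : ∀ {p q} → 0ℚ ℚ.≤ q → p ℚ.* p ℚ.≤ q ℚ.* q → p ℚ.≤ q
square-cancel-≤ {p} {q} 0≤q p²≤q² with p ℚ.≤? q
... | yes p≤q = p≤q
... | no p≰q = contradiction (ℚ.<-≤-trans q²<p² p²≤q²) (ℚ.<-irrefl refl)
  where
  q<p = ℚ.≰⇒> p≰q
  q²<p² : q ℚ.* q ℚ.< p ℚ.* p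
  q²<p² = ℚ.≤-<-trans (*-mono-≤ 0≤q 0≤q ℚ.≤-refl (ℚ.<⇒≤ q<p))
    (ℚ.*-monoˡ-<-pos p {{ℚ.positive (ℚ.≤-<-trans 0≤q q<p)}} q<p)

abstract
  -- Kept folded so that with-abstraction recognises it in goals.
  _≤?_ : ∀ p q → Dec (p ℚ.≤ q)
  _≤?_ = ℚ._≤?_

-- `ℚ._/_` normalises by a gcd and is stuck on a variable numerator, so the identity is checked
-- between unnormalised fractions. It drives every induction on `+ n ℚ./ 1` below.
/1-suc : ∀ n → + suc n ℚ./ 1 ≡ 1ℚ ℚ.+ + n ℚ./ 1
/1-suc n = ℚ.toℚᵘ-injective (begin
  ℚ.toℚᵘ (+ suc n ℚ./ 1)                 ≈⟨ ℚ.toℚᵘ-fromℚᵘ (ℚᵘ.mkℚᵘ (+ suc n) 0) ⟩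
  ℚᵘ.mkℚᵘ (+ suc n) 0                    ≈⟨ ℚᵘ.*≡* (cong (λ z → (+ 1 ℤ.+ z) ℤ.* + 1) (sym (ℤ.*-identityʳ (+ n)))) ⟩
  ℚᵘ.1ℚᵘ ℚᵘ.+ ℚᵘ.mkℚᵘ (+ n) 0            ≈⟨ ℚᵘ.+-congʳ ℚᵘ.1ℚᵘ (ℚᵘ.≃-sym (ℚ.toℚᵘ-fromℚᵘ (ℚᵘ.mkℚᵘ (+ n) 0))) ⟩
  ℚᵘ.1ℚᵘ ℚᵘ.+ ℚ.toℚᵘ (+ n ℚ./ 1)         ≈⟨ ℚᵘ.≃-sym (ℚ.toℚᵘ-homo-+ 1ℚ (+ n ℚ./ 1)) ⟩
  ℚ.toℚᵘ (1ℚ ℚ.+ + n ℚ./ 1)              ∎)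
  where open ℚᵘ.≃-Reasoning

0≤/1 : ∀ n → 0ℚ ℚ.≤ + n ℚ./ 1
0≤/1 n = ℚ.nonNegative⁻¹ _ {{ℚ.normalize-nonNeg n 1}}

/1-mono-≤ : ∀ {m n} → m ℕ.≤ n → + m ℚ./ 1 ℚ.≤ + n ℚ./ 1
/1-mono-≤ {n = n} ℕ.z≤n = 0≤/1 n
/1-mono-≤ (ℕ.s≤s {m} {n} m≤n) =
  subst₂ ℚ._≤_ (sym (/1-suc m)) (sym (/1-suc n)) (ℚ.+-monoʳ-≤ 1ℚ (/1-mono-≤ m≤n))

archimedean : ∀ p → ∃[ n ] p ℚ.≤ + n ℚ./ 1
archimedean p@(ℚ.mkℚ z d _) = ℤ.∣ z ∣ , ℚ.toℚᵘ-cancel-≤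
  (ℚᵘ.≤-respʳ-≃ (ℚᵘ.≃-sym (ℚ.toℚᵘ-fromℚᵘ (ℚᵘ.mkℚᵘ (+ ℤ.∣ z ∣) 0))) (ℚᵘ.*≤* (begin
    z ℤ.* + 1              ≡⟨ ℤ.*-identityʳ z ⟩
    z                      ≤⟨ i≤∣i∣ z ⟩
    + ℤ.∣ z ∣              ≡⟨ ℤ.*-identityʳ _ ⟨
    + ℤ.∣ z ∣ ℤ.* + 1      ≤⟨ ℤ.*-monoˡ-≤-nonNeg (+ ℤ.∣ z ∣) (ℤ.+≤+ (ℕ.s≤s ℕ.z≤n)) ⟩
    + ℤ.∣ z ∣ ℤ.* + suc d  ∎)))
  where
  open ℤ.≤-Reasoning
  i≤∣i∣ : ∀ i → i ℤ.≤ + ℤ.∣ i ∣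
  i≤∣i∣ (+ n)      = ℤ.≤-refl
  i≤∣i∣ (ℤ.-[1+ n ]) = ℤ.-≤+

reciprocal : ∀ {p} → 0ℚ ℚ.< p → ∃[ q ] (0ℚ ℚ.< q × q ℚ.* p ≡ 1ℚ)
reciprocal {p} 0<p = ℚ.1/ p , ℚ.positive⁻¹ _ {{ℚ.1/pos⇒pos p}} , ℚ.*-inverseˡ p
  where
  instance
    p-positive : ℚ.Positive p
    p-positive = ℚ.positive 0<p
    p-nonZero : ℚ.NonZero p
    p-nonZero = ℚ.pos⇒nonZero p

-- Square roots up to a factor of two, read off the grid 0, h, 2h, …, mh.
approximate-√ : ∀ {h p} m → 0ℚ ℚ.≤ h → h ℚ.* h ℚ.≤ p →
  p ℚ.≤ (+ m ℚ./ 1 ℚ.* h) ℚ.* (+ m ℚ./ 1 ℚ.* h) →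
  ∃[ r ] (0ℚ ℚ.≤ r × r ℚ.≤ + m ℚ./ 1 ℚ.* h × p ℚ.≤ r ℚ.* r × r ℚ.* r ℚ.≤ + 4 ℚ./ 1 ℚ.* p)
approximate-√ {h} {p} zero 0≤h h²≤p p≤ =
  0ℚ , ℚ.≤-refl , ℚ.≤-reflexive (sym (ℚ.*-zeroˡ h)) ,
  subst (p ℚ.≤_) (solve 1 (λ h → (con 0ℚ :* h) :* (con 0ℚ :* h) := con 0ℚ) refl h) p≤ ,
  0≤p*q (0≤/1 4) (ℚ.≤-trans (0≤p² h) h²≤p)
approximate-√ {h} {p} (suc m) 0≤h h²≤p p≤ with p ℚ.≤? (+ m ℚ./ 1 ℚ.* h) ℚ.* (+ m ℚ./ 1 ℚ.* h)
... | yes p≤′ with r , 0≤r , r≤ , p≤r² , r²≤4p ← approximate-√ m 0≤h h²≤p p≤′ =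
  r , 0≤r , ℚ.≤-trans r≤ (ℚ.*-monoʳ-≤-nonNeg h {{ℚ.nonNegative 0≤h}} (/1-mono-≤ (ℕ.n≤1+n m))) ,
  p≤r² , r²≤4p
... | no p≰ =
  + suc m ℚ./ 1 ℚ.* h , 0≤p*q (0≤/1 (suc m)) 0≤h , ℚ.≤-refl , p≤ ,
  subst (λ z → (z ℚ.* h) ℚ.* (z ℚ.* h) ℚ.≤ + 4 ℚ./ 1 ℚ.* p) (sym (/1-suc m))
    -- With g = mh, both g² and h² are at most p, and (g + h)² = 2g² + 2h² - (g - h)² ≤ 4p.
    (≤-by-difference
      (0≤p+q (0≤p² (g ℚ.- h))
        (0≤p+q (0≤p+q 0≤p-g² 0≤p-g²) (0≤p+q 0≤p-h² 0≤p-h²)))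
      (solve 3 (λ m h p →
          ((con 1ℚ :+ m) :* h) :* ((con 1ℚ :+ m) :* h) :+
            ((m :* h :- h) :* (m :* h :- h) :+
              (((p :- (m :* h) :* (m :* h)) :+ (p :- (m :* h) :* (m :* h))) :+
               ((p :- h :* h) :+ (p :- h :* h))))
          := con (+ 4 ℚ./ 1) :* p)
        refl (+ m ℚ./ 1) h p))
  where
  g = + m ℚ./ 1 ℚ.* h
  0≤p-g² : 0ℚ ℚ.≤ p ℚ.- g ℚ.* g
  0≤p-g² = p≤q⇒0≤q-p (ℚ.<⇒≤ (ℚ.≰⇒> p≰))
  0≤p-h² = p≤q⇒0≤q-p h²≤p

private
  4ℚ 1/4ℚ 1/16ℚ 4/3ℚ : ℚ
  4ℚ    = + 4 ℚ./ 1
  1/4ℚ  = + 1 ℚ./ 4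
  1/16ℚ = + 1 ℚ./ 16
  4/3ℚ  = + 4 ℚ./ 3

  variable
    n : ℕ

-- Finite sums, and sums over the differences of two inputs

sum-mono : ∀ {n} {u v : Vector ℚ n} → (∀ i → u i ℚ.≤ v i) → sum u ℚ.≤ sum v
sum-mono {zero}  u≤v = ℚ.≤-refl
sum-mono {suc n} u≤v = ℚ.+-mono-≤ (u≤v zero) (sum-mono (u≤v ∘ suc))

sum-const : ∀ n p → sum {n} (λ _ → p) ≡ + n ℚ./ 1 ℚ.* p
sum-const zero    p = sym (ℚ.*-zeroˡ p)
sum-const (suc n) p = begin
  p ℚ.+ sum {n} (λ _ → p)     ≡⟨ cong (p ℚ.+_) (sum-const n p) ⟩
  p ℚ.+ + n ℚ./ 1 ℚ.* p       ≡⟨ solve 2 (λ m p → p :+ m :* p := (con 1ℚ :+ m) :* p) refl (+ n ℚ./ 1) p ⟩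
  (1ℚ ℚ.+ + n ℚ./ 1) ℚ.* p    ≡⟨ cong (ℚ._* p) (/1-suc n) ⟨
  + suc n ℚ./ 1 ℚ.* p         ∎
  where open ≡-Reasoning

small-constant : ∀ n {δ} → 0ℚ ℚ.< δ → ∃[ ε ] (0ℚ ℚ.< ε × sum {n} (λ _ → ε) ℚ.≤ δ)
-- Dividing `δ` by `suc n` rather than by `n` also covers the empty sum.
small-constant n {δ} 0<δ with q , 0<q , q*n≡1 ← reciprocal {+ suc n ℚ./ 1} (ℚ.positive⁻¹ _ {{ℚ.normalize-pos (suc n) 1}}) =
  q ℚ.* δ , 0<ε , ℚ.≤-trans (ℚ.≤-reflexive (sum-const n (q ℚ.* δ)))
    (ℚ.≤-trans (ℚ.*-monoʳ-≤-nonNeg (q ℚ.* δ) {{ℚ.nonNegative (ℚ.<⇒≤ 0<ε)}} (/1-mono-≤ (ℕ.n≤1+n n)))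
      (ℚ.≤-reflexive (trans (solve 3 (λ s q d → s :* (q :* d) := (q :* s) :* d) refl (+ suc n ℚ./ 1) q δ)
        (trans (cong (ℚ._* δ) q*n≡1) (ℚ.*-identityˡ δ)))))
  where
  0<ε : 0ℚ ℚ.< q ℚ.* δ
  0<ε = ℚ.positive⁻¹ _ {{ℚ.pos*pos⇒pos q {{ℚ.positive 0<q}} δ {{ℚ.positive 0<δ}}}}

sum≠ : Input n → Input n → Vector ℚ n → ℚ
sum≠ x y u = sum λ i → if does (lookup x i ≟ lookup y i) then 0ℚ else u i

sum≠-mono : ∀ (x y : Input n) {u v} → (∀ i → lookup x i ≢ lookup y i → u i ℚ.≤ v i) →
            sum≠ x y u ℚ.≤ sum≠ x y v
sum≠-mono x y {u} {v} u≤v = sum-mono termwise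
  where
  termwise : ∀ i → (if does (lookup x i ≟ lookup y i) then 0ℚ else u i) ℚ.≤
                   (if does (lookup x i ≟ lookup y i) then 0ℚ else v i)
  termwise i with lookup x i ≟ lookup y i
  ... | yes _  = ℚ.≤-refl
  ... | no x≢y = u≤v i x≢y

sum≠-⊆ : ∀ (x y x′ y′ : Input n) {u v} → (∀ i → 0ℚ ℚ.≤ v i) →
  (∀ i → lookup x i ≢ lookup y i → lookup x′ i ≢ lookup y′ i × u i ℚ.≤ v i) →
  sum≠ x y u ℚ.≤ sum≠ x′ y′ v
sum≠-⊆ x y x′ y′ {u} {v} 0≤v u≤v = sum-mono termwise
  where
  termwise : ∀ i → (if does (lookup x i ≟ lookup y i) then 0ℚ else u i) ℚ.≤
                   (if does (lookup x′ i ≟ lookup y′ i) then 0ℚ else v i)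
  termwise i with lookup x i ≟ lookup y i | lookup x′ i ≟ lookup y′ i
  ... | yes _  | yes _    = ℚ.≤-refl
  ... | yes _  | no _     = 0≤v i
  ... | no x≢y | yes x′≡y′ = contradiction x′≡y′ (proj₁ (u≤v i x≢y))
  ... | no x≢y | no _     = proj₂ (u≤v i x≢y)

sum≠≤sum : ∀ (x y : Input n) {u} → (∀ i → 0ℚ ℚ.≤ u i) → sum≠ x y u ℚ.≤ sum u
sum≠≤sum x y {u} 0≤u = sum-mono termwise
  where
  termwise : ∀ i → (if does (lookup x i ≟ lookup y i) then 0ℚ else u i) ℚ.≤ u i
  termwise i with lookup x i ≟ lookup y i
  ... | yes _ = 0≤u i
  ... | no  _ = ℚ.≤-refl

sum≠-+ : ∀ (x y : Input n) u v → sum≠ x y (λ i → u i ℚ.+ v i) ≡ sum≠ x y u ℚ.+ sum≠ x y v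
sum≠-+ x y u v = trans (sum-cong-≗ (λ i → termwise (does (lookup x i ≟ lookup y i)) i))
  (∑-distrib-+ (λ i → if does (lookup x i ≟ lookup y i) then 0ℚ else u i)
               (λ i → if does (lookup x i ≟ lookup y i) then 0ℚ else v i))
  where
  termwise : ∀ b i → (if b then 0ℚ else u i ℚ.+ v i) ≡
                     (if b then 0ℚ else u i) ℚ.+ (if b then 0ℚ else v i)
  termwise true  i = refl
  termwise false i = refl

sum≠-* : ∀ (x y : Input n) p u → sum≠ x y (λ i → p ℚ.* u i) ≡ p ℚ.* sum≠ x y u
sum≠-* x y p u = trans (sum-cong-≗ (λ i → termwise (does (lookup x i ≟ lookup y i)) i))
  (sym (*-distribˡ-sum p (λ i → if does (lookup x i ≟ lookup y i) then 0ℚ else u i)))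
  where
  termwise : ∀ b i → (if b then 0ℚ else p ℚ.* u i) ≡ p ℚ.* (if b then 0ℚ else u i)
  termwise true  i = sym (ℚ.*-zeroʳ p)
  termwise false i = refl

sum≠-refl : ∀ (x : Input n) u → sum≠ x x u ≡ 0ℚ
sum≠-refl []      u = refl
sum≠-refl (a ∷ x) u rewrite dec-true (a ≟ a) refl =
  trans (ℚ.+-identityˡ _) (sum≠-refl x (u ∘ suc))

sum≠-update : ∀ (x : Input n) i b u → 0ℚ ℚ.≤ u i → sum≠ x (x [ i ]≔ b) u ℚ.≤ u i
sum≠-update (a ∷ x) zero b u 0≤u rewrite sum≠-refl x (u ∘ suc) with a ≟ b
... | yes _ = 0≤u
... | no  _ = ℚ.≤-reflexive (ℚ.+-identityʳ (u zero))
sum≠-update (a ∷ x) (suc i) b u 0≤u rewrite dec-true (a ≟ a) refl =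
  ℚ.≤-trans (ℚ.≤-reflexive (ℚ.+-identityˡ _)) (sum≠-update x i b (u ∘ suc) 0≤u)

-- Truncation at 1 is subadditive on nonnegative numbers: either neither term is truncated, or one
-- of them alone already reaches 1.
sum-⊓1 : ∀ {n} (u : Vector ℚ n) → (∀ i → 0ℚ ℚ.≤ u i) → sum u ℚ.⊓ 1ℚ ℚ.≤ sum (λ i → u i ℚ.⊓ 1ℚ)
sum-⊓1 {zero}  u 0≤u = ℚ.p⊓q≤p 0ℚ 1ℚ
sum-⊓1 {suc n} u 0≤u = ℚ.≤-trans (subadditive (0≤u zero) (sum-nonneg (0≤u ∘ suc)))
  (ℚ.+-monoʳ-≤ (u zero ℚ.⊓ 1ℚ) (sum-⊓1 (u ∘ suc) (0≤u ∘ suc)))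
  where
  sum-nonneg : ∀ {n} {u : Vector ℚ n} → (∀ i → 0ℚ ℚ.≤ u i) → 0ℚ ℚ.≤ sum u
  sum-nonneg {zero}  0≤u = ℚ.≤-refl
  sum-nonneg {suc n} 0≤u = 0≤p+q (0≤u zero) (sum-nonneg (0≤u ∘ suc))

  subadditive : ∀ {p q} → 0ℚ ℚ.≤ p → 0ℚ ℚ.≤ q → (p ℚ.+ q) ℚ.⊓ 1ℚ ℚ.≤ p ℚ.⊓ 1ℚ ℚ.+ q ℚ.⊓ 1ℚ
  subadditive {p} {q} 0≤p 0≤q with ℚ.⊓-sel p 1ℚ | ℚ.⊓-sel q 1ℚ
  ... | inj₁ p≡ | inj₁ q≡ rewrite p≡ | q≡ = ℚ.p⊓q≤p (p ℚ.+ q) 1ℚ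
  ... | inj₂ p≡ | _ rewrite p≡ = ℚ.≤-trans (ℚ.p⊓q≤q (p ℚ.+ q) 1ℚ)
    (ℚ.+-monoʳ-≤ 1ℚ (ℚ.⊓-glb 0≤q (ℚ.nonNegative⁻¹ 1ℚ)))
  ... | inj₁ p≡ | inj₂ q≡ rewrite p≡ | q≡ = ℚ.≤-trans (ℚ.p⊓q≤q (p ℚ.+ q) 1ℚ)
    (ℚ.+-monoˡ-≤ 1ℚ 0≤p)

sum≠-⊓1 : ∀ (x y : Input n) {u} → (∀ i → 0ℚ ℚ.≤ u i) → 1ℚ ℚ.≤ sum≠ x y u →
          1ℚ ℚ.≤ sum≠ x y (λ i → u i ℚ.⊓ 1ℚ)
sum≠-⊓1 x y {u} 0≤u 1≤ = ℚ.≤-trans (ℚ.⊓-glb 1≤ ℚ.≤-refl)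
  (ℚ.≤-trans (sum-⊓1 _ (λ i → nonneg (does (lookup x i ≟ lookup y i)) i))
    (ℚ.≤-reflexive (sum-cong-≗ (λ i → truncated (does (lookup x i ≟ lookup y i)) i))))
  where
  nonneg : ∀ b i → 0ℚ ℚ.≤ (if b then 0ℚ else u i)
  nonneg true  i = ℚ.≤-refl
  nonneg false i = 0≤u i
  truncated : ∀ b i → (if b then 0ℚ else u i) ℚ.⊓ 1ℚ ≡ (if b then 0ℚ else u i ℚ.⊓ 1ℚ)
  truncated true  i = refl
  truncated false i = refl

-- Hamming distance and single flips

hamming : Input n → Input n → ℕ
hamming []      []      = 0
hamming (a ∷ x) (b ∷ y) = (if does (a ≟ b) then 0 else 1) ℕ.+ hamming x y

hamming-update : ∀ (x y : Input n) i → lookup x i ≢ lookup y i →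
                 hamming x (y [ i ]≔ lookup x i) ℕ.< hamming x y
hamming-update (a ∷ x) (b ∷ y) zero a≢b
  rewrite dec-true (a ≟ a) refl | dec-false (a ≟ b) a≢b = ℕ.≤-refl
hamming-update (a ∷ x) (b ∷ y) (suc i) x≢y =
  ℕ.+-monoʳ-< (if does (a ≟ b) then 0 else 1) (hamming-update x y i x≢y)

lookup-update-≢ : ∀ (x y : Input n) i j →
  lookup x j ≢ lookup (y [ i ]≔ lookup x i) j → lookup x j ≢ lookup y j
lookup-update-≢ x y i j x≢ x≡y with i Fin.≟ j
... | yes refl = x≢ (sym (lookup∘update i y (lookup x i)))
... | no  i≢j  = x≢ (trans x≡y (sym (lookup∘update′ (i≢j ∘ sym) y (lookup x i))))

-- Fractional certificates with rational weights

NonNegative : (Input n → Vector ℚ n) → Set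
NonNegative v = ∀ x i → 0ℚ ℚ.≤ v x i

Covering : BoolFun n → (Input n → Vector ℚ n) → Set
Covering f v = ∀ x y → f y ≢ f x → 1ℚ ℚ.≤ sum≠ x y (v x)

record Certificates (f : BoolFun n) (S : ℚ) : Set where
  field
    weight : Input n → Vector ℚ n
    nonneg : NonNegative weight
    covers : Covering f weight
    total  : ∀ x → sum (weight x) ℚ.≤ S

heavier : Vector ℚ n → Vector ℚ n → Input n → Input n → Input n
heavier u v x y = tabulate λ i → if does (v i ≤? u i) then lookup x i else lookup y i

heavier-≢ˡ : ∀ u v (x y : Input n) i → lookup x i ≢ lookup (heavier u v x y) i →
             lookup x i ≢ lookup y i × u i ℚ.≤ u i ℚ.⊓ v i
heavier-≢ˡ u v x y i x≢z
  rewrite lookup∘tabulate (λ i → if does (v i ≤? u i) then lookup x i else lookup y i) i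
  with v i ≤? u i
... | yes _  = contradiction refl x≢z
... | no v≰u = x≢z , ℚ.⊓-glb ℚ.≤-refl (ℚ.<⇒≤ (ℚ.≰⇒> v≰u))

heavier-≢ʳ : ∀ u v (x y : Input n) i → lookup y i ≢ lookup (heavier u v x y) i →
             lookup x i ≢ lookup y i × v i ℚ.≤ u i ℚ.⊓ v i
heavier-≢ʳ u v x y i y≢z
  rewrite lookup∘tabulate (λ i → if does (v i ≤? u i) then lookup x i else lookup y i) i
  with v i ≤? u i
... | yes v≤u = y≢z ∘ sym , ℚ.⊓-glb v≤u ℚ.≤-refl
... | no _    = contradiction refl y≢z

-- Let z agree, in each coordinate, with whichever of x and y gives it more weight.
-- Then f z differs from f x or from f y, say from f x, and v x i ≤ v y i wherever
-- z differs from x.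
covering-⊓ : ∀ {f : BoolFun n} {v} → NonNegative v → Covering f v →
  ∀ x y → f x ≢ f y → 1ℚ ℚ.≤ sum≠ x y (λ i → v x i ℚ.⊓ v y i)
covering-⊓ {f = f} {v} 0≤v covers x y fx≢fy with f (heavier (v x) (v y) x y) ≟ f x
... | yes fz≡fx = ℚ.≤-trans
  (covers y (heavier (v x) (v y) x y) (λ fz≡fy → fx≢fy (trans (sym fz≡fx) fz≡fy)))
  (sum≠-⊆ y (heavier (v x) (v y) x y) x y (λ i → ℚ.⊓-glb (0≤v x i) (0≤v y i)) (heavier-≢ʳ (v x) (v y) x y))
... | no fz≢fx = ℚ.≤-trans (covers x (heavier (v x) (v y) x y) fz≢fx)
  (sum≠-⊆ x (heavier (v x) (v y) x y) x y (λ i → ℚ.⊓-glb (0≤v x i) (0≤v y i)) (heavier-≢ˡ (v x) (v y) x y))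

-- Sensitivity and discarding small weights

threshold : ℚ → ℚ → ℚ
threshold θ p = if does (p ≤? θ) then 0ℚ else p

threshold-nonneg : ∀ θ {p} → 0ℚ ℚ.≤ p → 0ℚ ℚ.≤ threshold θ p
threshold-nonneg θ {p} 0≤p with p ≤? θ
... | yes _ = ℚ.≤-refl
... | no  _ = 0≤p

threshold-upper : ∀ θ {p} → 0ℚ ℚ.≤ p → threshold θ p ℚ.≤ p
threshold-upper θ {p} 0≤p with p ≤? θ
... | yes _ = 0≤p
... | no  _ = ℚ.≤-refl

threshold-lower : ∀ {θ} p → 0ℚ ℚ.≤ θ → p ℚ.- θ ℚ.≤ threshold θ p
threshold-lower {θ} p 0≤θ with p ≤? θ
... | yes p≤θ = ≤-by-difference (p≤q⇒0≤q-p p≤θ)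
  (solve 2 (λ p t → (p :- t) :+ (t :- p) := con 0ℚ) refl p θ)
... | no  _   = ≤-by-difference 0≤θ (solve 2 (λ p t → (p :- t) :+ t := p) refl p θ)

threshold-gap : ∀ θ p → threshold θ p ≡ 0ℚ ⊎ θ ℚ.≤ threshold θ p
threshold-gap θ p with p ≤? θ
... | yes _  = inj₁ refl
... | no p≰θ = inj₂ (ℚ.<⇒≤ (ℚ.≰⇒> p≰θ))

module _ {f : BoolFun n} {S : ℚ} (certificates : Certificates f S) where

  open Certificates certificates

  -- If flipping y in coordinate i alone changes f, then i is the only coordinate on which
  -- `weight y` can cover that pair, so `weight y i` is at least 1. The number of such i is
  -- therefore at most the total of `weight y`.
  sensitivity≤ : ∀ x y → (∀ i → lookup x i ≢ lookup y i → f (y [ i ]≔ lookup x i) ≢ f y) →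
                 sum≠ x y (λ _ → 1ℚ) ℚ.≤ S
  sensitivity≤ x y sensitive = ℚ.≤-trans
    (sum≠-mono x y (λ i x≢y → ℚ.≤-trans (covers y _ (sensitive i x≢y))
      (sum≠-update y i (lookup x i) (weight y) (nonneg y i))))
    (ℚ.≤-trans (sum≠≤sum x y (nonneg y)) (total y))

  sparse : ℚ → Input n → Vector ℚ n
  sparse θ x i = threshold θ (weight x i ℚ.+ weight x i)

  sparse-nonneg : ∀ θ → NonNegative (sparse θ)
  sparse-nonneg θ x i = threshold-nonneg θ (0≤p+q (nonneg x i) (nonneg x i))

  sparse-total : ∀ θ x → sum (sparse θ x) ℚ.≤ S ℚ.+ S
  sparse-total θ x = ℚ.≤-trans
    (sum-mono (λ i → threshold-upper θ (0≤p+q (nonneg x i) (nonneg x i))))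
    (ℚ.≤-trans (ℚ.≤-reflexive (∑-distrib-+ (weight x) (weight x))) (ℚ.+-mono-≤ (total x) (total x)))

  -- A minimal block of differences is sensitive in each coordinate after it is
  -- flipped, so it has at most S elements and the discarded weights on it add
  -- up to at most S * θ.
  sparse-covers : ∀ {θ} → 0ℚ ℚ.≤ θ → θ ℚ.* S ℚ.≤ 1ℚ → Covering f (sparse θ)
  sparse-covers {θ} 0≤θ θS≤1 x y = go y (<-wellFounded (hamming x y))
    where
    go : ∀ y → Acc ℕ._<_ (hamming x y) → f y ≢ f x → 1ℚ ℚ.≤ sum≠ x y (sparse θ x)
    go y (acc smaller) fy≢fx
      with Fin.any? (λ i → ¬? (lookup x i ≟ lookup y i) ×-dec ¬? (f (y [ i ]≔ lookup x i) ≟ f x))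
    -- Resetting coordinate i to its value in x keeps the function value different from f x and only
    -- removes a difference, so a cover of the smaller block covers the larger one.
    ... | yes (i , x≢y , fy′≢fx) = ℚ.≤-trans
      (go (y [ i ]≔ lookup x i) (smaller (hamming-update x y i x≢y)) fy′≢fx)
      (sum≠-⊆ x (y [ i ]≔ lookup x i) x y (sparse-nonneg θ x) (λ j x≢y′ → lookup-update-≢ x y i j x≢y′ , ℚ.≤-refl))
    ... | no minimal = ℚ.≤-trans
      -- With c the weight of x on the block and k the size of the block, 2c - θk ≥ 2 - θS ≥ 1.
      (≤-by-difference (0≤p+q (0≤p+q (p≤q⇒0≤q-p cover) (p≤q⇒0≤q-p cover))
          (0≤p+q (0≤p*q 0≤θ (p≤q⇒0≤q-p few)) (p≤q⇒0≤q-p θS≤1)))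
        (solve 4 (λ c s t k →
            con 1ℚ :+ (((c :- con 1ℚ) :+ (c :- con 1ℚ)) :+ (t :* (s :- k) :+ (con 1ℚ :- t :* s)))
            := (c :+ c) :+ (con 0ℚ :- t) :* k)
          refl (sum≠ x y (weight x)) S θ (sum≠ x y (λ _ → 1ℚ))))
      (ℚ.≤-trans (ℚ.≤-reflexive (sym lower-sum)) (sum≠-mono x y (λ i _ → lower i)))
      where
      cover = covers x y fy≢fx

      few : sum≠ x y (λ _ → 1ℚ) ℚ.≤ S
      few = sensitivity≤ x y λ i x≢y fy′≡fy → minimal (i , x≢y , fy≢fx ∘ trans (sym fy′≡fy))

      lower : ∀ i → (weight x i ℚ.+ weight x i) ℚ.+ (0ℚ ℚ.- θ) ℚ.* 1ℚ ℚ.≤ sparse θ x i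
      lower i = ℚ.≤-trans
        (ℚ.≤-reflexive (solve 2 (λ w t → (w :+ w) :+ (con 0ℚ :- t) :* con 1ℚ := (w :+ w) :- t)
          refl (weight x i) θ))
        (threshold-lower (weight x i ℚ.+ weight x i) 0≤θ)

      lower-sum : sum≠ x y (λ i → (weight x i ℚ.+ weight x i) ℚ.+ (0ℚ ℚ.- θ) ℚ.* 1ℚ) ≡
        (sum≠ x y (weight x) ℚ.+ sum≠ x y (weight x)) ℚ.+ (0ℚ ℚ.- θ) ℚ.* sum≠ x y (λ _ → 1ℚ)
      lower-sum = trans
        (sum≠-+ x y (λ i → weight x i ℚ.+ weight x i) (λ _ → (0ℚ ℚ.- θ) ℚ.* 1ℚ))
        (cong₂ ℚ._+_ (sum≠-+ x y (weight x) (weight x)) (sum≠-* x y (0ℚ ℚ.- θ) (λ _ → 1ℚ)))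

-- From fractional to expectational certificates

record ExpectationalCertificates (f : BoolFun n) (T : ℚ) : Set where
  field
    weight : Input n → Vector ℚ n
    nonneg : NonNegative weight
    ≤one   : ∀ x i → weight x i ℚ.≤ 1ℚ
    covers : ∀ x y → f x ≢ f y → 1ℚ ℚ.≤ sum≠ x y (λ i → weight x i ℚ.* weight y i)
    total  : ∀ x → sum (weight x) ℚ.≤ T

-- The smaller of r and s has its square below r * s. This turns covering by minima into covering by
-- products of approximate roots.
p⊓q≤r*s : ∀ {p q r s} → 0ℚ ℚ.≤ r → 0ℚ ℚ.≤ s → p ℚ.≤ r ℚ.* r → q ℚ.≤ s ℚ.* s →
          p ℚ.⊓ q ℚ.≤ r ℚ.* s
p⊓q≤r*s {p} {q} {r} {s} 0≤r 0≤s p≤r² q≤s² with ℚ.≤-total r s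
... | inj₁ r≤s = ℚ.≤-trans (ℚ.p⊓q≤p p q) (ℚ.≤-trans p≤r² (*-mono-≤ 0≤r 0≤r ℚ.≤-refl r≤s))
... | inj₂ s≤r = ℚ.≤-trans (ℚ.p⊓q≤q p q) (ℚ.≤-trans q≤s² (*-mono-≤ 0≤s 0≤s s≤r ℚ.≤-refl))

-- Starting bound for `approximate-√` on the grid of step 1: the last grid point m satisfies p ≤ m ≤
-- m².
1≤m⇒p≤[m*1]² : ∀ {p} m → 1ℚ ℚ.≤ p → p ℚ.≤ + m ℚ./ 1 →
               p ℚ.≤ (+ m ℚ./ 1 ℚ.* 1ℚ) ℚ.* (+ m ℚ./ 1 ℚ.* 1ℚ)
1≤m⇒p≤[m*1]² {p} m 1≤p p≤m = subst (p ℚ.≤_)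
  (cong₂ ℚ._*_ (sym (ℚ.*-identityʳ (+ m ℚ./ 1))) (sym (ℚ.*-identityʳ (+ m ℚ./ 1))))
  (subst (ℚ._≤ (+ m ℚ./ 1) ℚ.* (+ m ℚ./ 1)) (ℚ.*-identityˡ p)
    (*-mono-≤ (ℚ.nonNegative⁻¹ 1ℚ) (ℚ.≤-trans (ℚ.nonNegative⁻¹ 1ℚ) 1≤p) (ℚ.≤-trans 1≤p p≤m) p≤m))

module _ {S : ℚ} (1≤S : 1ℚ ℚ.≤ S) where

  private
    0≤S : 0ℚ ℚ.≤ S
    0≤S = ℚ.≤-trans (ℚ.nonNegative⁻¹ 1ℚ) 1≤S

    1≤4S : 1ℚ ℚ.≤ 4ℚ ℚ.* S
    1≤4S = *-mono-≤ {1ℚ} {4ℚ} {1ℚ} (ℚ.nonNegative⁻¹ 1ℚ) (ℚ.nonNegative⁻¹ 1ℚ) (ℚ.*≤* (ℤ.+≤+ (ℕ.s≤s ℕ.z≤n))) 1≤S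

  -- The number t stands for 2√S up to a factor of two; it converts weights of size at least 1/S
  -- into bounds on their roots.
  √-scale : ∃[ t ] (0ℚ ℚ.≤ t × 4ℚ ℚ.* S ℚ.≤ t ℚ.* t × t ℚ.* t ℚ.≤ 4ℚ ℚ.* (4ℚ ℚ.* S))
  √-scale =
    let m , 4S≤m = archimedean (4ℚ ℚ.* S)
        t , 0≤t , _ , ≤t² , t²≤ = approximate-√ {1ℚ} {4ℚ ℚ.* S} m (ℚ.nonNegative⁻¹ 1ℚ) 1≤4S
          (1≤m⇒p≤[m*1]² m 1≤4S 4S≤m)
    in t , 0≤t , ≤t² , t²≤

  1/S≤1 : ∀ {θ} → θ ℚ.* S ≡ 1ℚ → 0ℚ ℚ.≤ θ → θ ℚ.≤ 1ℚ
  1/S≤1 {θ} θS≡1 0≤θ =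
    subst₂ ℚ._≤_ (ℚ.*-identityʳ θ) θS≡1 (*-mono-≤ 0≤θ (ℚ.nonNegative⁻¹ 1ℚ) ℚ.≤-refl 1≤S)

  -- Here h = 1/m ≤ 1/S = θ ≤ 1, so h² ≤ h ≤ θ: the grid of step h is fine enough for the root of
  -- every weight that is at least θ.
  h²≤θ : ∀ {θ h m} → θ ℚ.* S ≡ 1ℚ → 0ℚ ℚ.≤ θ → 0ℚ ℚ.≤ h → S ℚ.≤ m → h ℚ.* m ≡ 1ℚ →
         h ℚ.* h ℚ.≤ θ
  h²≤θ {θ} {h} {m} θS≡1 0≤θ 0≤h S≤m hm≡1 = ℚ.≤-trans
    (subst (h ℚ.* h ℚ.≤_) (ℚ.*-identityʳ h)
      (*-mono-≤ 0≤h 0≤h ℚ.≤-refl (ℚ.≤-trans h≤θ (1/S≤1 θS≡1 0≤θ))))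
    h≤θ
    where
    open ≡-Reasoning
    h≤θ : h ℚ.≤ θ
    h≤θ = ≤-by-difference (0≤p*q (0≤p*q 0≤h 0≤θ) (p≤q⇒0≤q-p S≤m)) (begin
      h ℚ.+ (h ℚ.* θ) ℚ.* (m ℚ.- S)
        ≡⟨ cong (ℚ._+ (h ℚ.* θ) ℚ.* (m ℚ.- S)) (trans (cong (ℚ._* h) θS≡1) (ℚ.*-identityˡ h)) ⟨
      (θ ℚ.* S) ℚ.* h ℚ.+ (h ℚ.* θ) ℚ.* (m ℚ.- S)
        ≡⟨ solve 4 (λ h m t s → (t :* s) :* h :+ (h :* t) :* (m :- s) := t :* (h :* m)) refl h m θ S ⟩
      θ ℚ.* (h ℚ.* m)
        ≡⟨ trans (cong (θ ℚ.*_) hm≡1) (ℚ.*-identityʳ θ) ⟩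
      θ ∎)

  -- For p ≥ θ = 1/S the approximate root satisfies r² ≤ 4p = 4θSp ≤ 4Sp² ≤ (tp)². The resulting
  -- bound r ≤ tp is linear in p and can be summed.
  √-weight : ∀ {θ t p} → θ ℚ.* S ≡ 1ℚ → 0ℚ ℚ.≤ t → 4ℚ ℚ.* S ℚ.≤ t ℚ.* t →
    0ℚ ℚ.≤ θ → p ℚ.≤ 1ℚ → p ≡ 0ℚ ⊎ θ ℚ.≤ p →
    ∃[ r ] (0ℚ ℚ.≤ r × r ℚ.≤ 1ℚ × p ℚ.≤ r ℚ.* r × r ℚ.≤ t ℚ.* p)
  √-weight {t = t} _ _ _ _ _ (inj₁ refl) =
    0ℚ , ℚ.≤-refl , ℚ.nonNegative⁻¹ 1ℚ , ℚ.≤-refl , ℚ.≤-reflexive (sym (ℚ.*-zeroʳ t))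
  √-weight {θ} {t} {p} θS≡1 0≤t 4S≤t² 0≤θ p≤1 (inj₂ θ≤p) =
    let m , S≤m = archimedean S
        h , 0<h , hm≡1 = reciprocal {+ m ℚ./ 1}
          (ℚ.<-≤-trans (ℚ.positive⁻¹ 1ℚ) (ℚ.≤-trans 1≤S S≤m))
        mh≡1 = trans (ℚ.*-comm (+ m ℚ./ 1) h) hm≡1
        -- The m-th point of the grid of step h = 1/m is 1. Hence p ≤ 1 starts the search, and the
        -- root found is at most 1.
        r , 0≤r , r≤ , p≤r² , r²≤4p = approximate-√ {h} {p} m (ℚ.<⇒≤ 0<h)
          (ℚ.≤-trans (h²≤θ θS≡1 0≤θ (ℚ.<⇒≤ 0<h) S≤m hm≡1) θ≤p)
          (subst (p ℚ.≤_) (sym (cong₂ ℚ._*_ mh≡1 mh≡1)) p≤1)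
    in r , 0≤r , subst (r ℚ.≤_) mh≡1 r≤ , p≤r² ,
       square-cancel-≤ (0≤p*q 0≤t 0≤p) (ℚ.≤-trans r²≤4p 4p≤)
    where
    0≤p : 0ℚ ℚ.≤ p
    0≤p = ℚ.≤-trans 0≤θ θ≤p

    4p≤ : 4ℚ ℚ.* p ℚ.≤ (t ℚ.* p) ℚ.* (t ℚ.* p)
    4p≤ = begin
      4ℚ ℚ.* p                            ≡⟨ cong (4ℚ ℚ.*_) (trans (cong (ℚ._* p) θS≡1) (ℚ.*-identityˡ p)) ⟨
      4ℚ ℚ.* ((θ ℚ.* S) ℚ.* p)            ≤⟨ ≤-by-difference
        (0≤p*q (0≤p*q (0≤p*q (ℚ.nonNegative⁻¹ 4ℚ) 0≤S) 0≤p) (p≤q⇒0≤q-p θ≤p))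
        (solve 4 (λ c t s p → c :* ((t :* s) :* p) :+ ((c :* s) :* p) :* (p :- t) := (c :* s) :* (p :* p))
          refl 4ℚ θ S p) ⟩
      (4ℚ ℚ.* S) ℚ.* (p ℚ.* p)            ≤⟨ *-mono-≤ (0≤p*q (ℚ.nonNegative⁻¹ 4ℚ) 0≤S) (0≤p*q 0≤p 0≤p) 4S≤t² ℚ.≤-refl ⟩
      (t ℚ.* t) ℚ.* (p ℚ.* p)             ≡⟨ solve 2 (λ t p → (t :* t) :* (p :* p) := (t :* p) :* (t :* p)) refl t p ⟩
      (t ℚ.* p) ℚ.* (t ℚ.* p)             ∎
      where open ℚ.≤-Reasoning

  √-certificates : ∀ {f : BoolFun n} {θ t} → Certificates f S → θ ℚ.* S ≡ 1ℚ → 0ℚ ℚ.≤ t →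
    4ℚ ℚ.* S ℚ.≤ t ℚ.* t → 0ℚ ℚ.≤ θ → ExpectationalCertificates f (t ℚ.* (S ℚ.+ S))
  √-certificates {f = f} {θ} {t} C θS≡1 0≤t 4S≤t² 0≤θ = record
    { weight = λ x i → proj₁ (root x i)
    ; nonneg = λ x i → proj₁ (proj₂ (root x i))
    ; ≤one   = λ x i → proj₁ (proj₂ (proj₂ (root x i)))
    ; covers = λ x y fx≢fy → ℚ.≤-trans (covering-⊓ u-nonneg u-covers x y fx≢fy)
        (sum≠-mono x y (λ i _ → p⊓q≤r*s
          (proj₁ (proj₂ (root x i))) (proj₁ (proj₂ (root y i)))
          (proj₁ (proj₂ (proj₂ (proj₂ (root x i))))) (proj₁ (proj₂ (proj₂ (proj₂ (root y i)))))))
    ; total  = λ x → ℚ.≤-trans (sum-mono (λ i → proj₂ (proj₂ (proj₂ (proj₂ (root x i))))))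
        (ℚ.≤-trans (ℚ.≤-reflexive (sym (*-distribˡ-sum t (u x))))
          (ℚ.*-monoˡ-≤-nonNeg t {{ℚ.nonNegative 0≤t}}
            (ℚ.≤-trans (sum-mono (λ i → ℚ.p⊓q≤p (sparse C θ x i) 1ℚ)) (sparse-total C θ x))))
    }
    where
    u : Input _ → Vector ℚ _
    -- The cap keeps the roots at most 1. Covering survives it by `sum≠-⊓1`, and the gap between 0
    -- and `θ` survives because `θ` is at most 1.
    u x i = sparse C θ x i ℚ.⊓ 1ℚ

    u-nonneg : NonNegative u
    u-nonneg x i = ℚ.⊓-glb (sparse-nonneg C θ x i) (ℚ.nonNegative⁻¹ 1ℚ)

    u-covers : Covering f u
    u-covers x y fy≢fx = sum≠-⊓1 x y (sparse-nonneg C θ x)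
      (sparse-covers C 0≤θ (ℚ.≤-reflexive θS≡1) x y fy≢fx)

    u-gap : ∀ x i → u x i ≡ 0ℚ ⊎ θ ℚ.≤ u x i
    u-gap x i with threshold-gap θ (Certificates.weight C x i ℚ.+ Certificates.weight C x i)
    ... | inj₁ ≡0 = inj₁ (cong (ℚ._⊓ 1ℚ) ≡0)
    ... | inj₂ θ≤ = inj₂ (ℚ.⊓-glb θ≤ (1/S≤1 θS≡1 0≤θ))

    root : ∀ x i → ∃[ r ] (0ℚ ℚ.≤ r × r ℚ.≤ 1ℚ × u x i ℚ.≤ r ℚ.* r × r ℚ.≤ t ℚ.* u x i)
    root x i = √-weight θS≡1 0≤t 4S≤t² 0≤θ (ℚ.p⊓q≤q (sparse C θ x i) 1ℚ) (u-gap x i)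

  -- The total is T = 2tS with t² ≤ 16S. Bounding T² by a multiple of S³ expresses T = O(S^{3/2})
  -- within the rationals.
  expectational : ∀ {f : BoolFun n} → Certificates f S →
    ∃[ T ] (ExpectationalCertificates f T × T ℚ.* T ℚ.≤ + 64 ℚ./ 1 ℚ.* (S ℚ.* S ℚ.* S))
  expectational C =
    let θ , 0<θ , θS≡1 = reciprocal (ℚ.<-≤-trans (ℚ.positive⁻¹ 1ℚ) 1≤S)
        t , 0≤t , 4S≤t² , t²≤16S = √-scale
    in t ℚ.* (S ℚ.+ S) , √-certificates C θS≡1 0≤t 4S≤t² (ℚ.<⇒≤ 0<θ) , T²≤ t t²≤16S
    where
    T²≤ : ∀ t → t ℚ.* t ℚ.≤ 4ℚ ℚ.* (4ℚ ℚ.* S) →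
          (t ℚ.* (S ℚ.+ S)) ℚ.* (t ℚ.* (S ℚ.+ S)) ℚ.≤ + 64 ℚ./ 1 ℚ.* (S ℚ.* S ℚ.* S)
    T²≤ t t²≤16S = ℚ.≤-trans
      (ℚ.≤-reflexive (solve 2 (λ t s → (t :* (s :+ s)) :* (t :* (s :+ s)) := (t :* t) :* ((s :+ s) :* (s :+ s))) refl t S))
      (ℚ.≤-trans (*-mono-≤ (0≤p² t) (0≤p² (S ℚ.+ S)) t²≤16S ℚ.≤-refl)
        (ℚ.≤-reflexive (solve 1 (λ s →
            (con 4ℚ :* (con 4ℚ :* s)) :* ((s :+ s) :* (s :+ s)) := con (+ 64 ℚ./ 1) :* (s :* s :* s))
          refl S)))

-- Real certificates

-- An inequality between reals holds, up to a given error, from some index on. The combinators below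
-- merge finitely many such facts, also over all coordinates or all inputs, at a common index.
Eventually : (ℕ → Set) → Set
Eventually P = ∃[ N ] (∀ k → N ℕ.≤ k → P k)

always : {P : ℕ → Set} → (∀ k → P k) → Eventually P
always p = 0 , λ k _ → p k

eventually-map : {P Q : ℕ → Set} → (∀ k → P k → Q k) → Eventually P → Eventually Q
eventually-map f (N , p) = N , λ k N≤k → f k (p k N≤k)

infixr 4 _⟨×⟩_
_⟨×⟩_ : {P Q : ℕ → Set} → Eventually P → Eventually Q → Eventually (λ k → P k × Q k)
(M , p) ⟨×⟩ (N , q) =
  M ℕ.⊔ N , λ k ≤k → p k (ℕ.m⊔n≤o⇒m≤o M N ≤k) , q k (ℕ.m⊔n≤o⇒n≤o M N ≤k)

eventually-∀Fin : ∀ {m} {P : Fin m → ℕ → Set} → (∀ i → Eventually (P i)) →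
                  Eventually (λ k → ∀ i → P i k)
eventually-∀Fin {zero}  p = always λ _ ()
eventually-∀Fin {suc m} p = eventually-map
  (λ { k (p₀ , pₛ) zero → p₀ ; k (p₀ , pₛ) (suc i) → pₛ i })
  (p zero ⟨×⟩ eventually-∀Fin (p ∘ suc))

eventually-∀Input : {P : Input n → ℕ → Set} → (∀ x → Eventually (P x)) →
                    Eventually (λ k → ∀ x → P x k)
eventually-∀Input {zero}  p = eventually-map (λ { k p₀ [] → p₀ }) (p [])
eventually-∀Input {suc n} p = eventually-map
  (λ { k (p₀ , p₁) (false ∷ x) → p₀ x ; k (p₀ , p₁) (true ∷ x) → p₁ x })
  (eventually-∀Input (p ∘ (false ∷_)) ⟨×⟩ eventually-∀Input (p ∘ (true ∷_)))

seq-∑ : (v : Vector ℝ n) → ∀ k → seq (∑ v) k ≡ sum (λ i → seq (v i) k)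
seq-∑ {zero}  v k = refl
seq-∑ {suc n} v k = cong (seq (v zero) k ℚ.+_) (seq-∑ (v ∘ suc) k)

seq-∑-if : ∀ (b : Fin n → Bool) (v : Vector ℝ n) k →
  seq (∑ λ i → if b i then 0ℝ else v i) k ≡ sum (λ i → if b i then 0ℚ else seq (v i) k)
seq-∑-if b v k = trans (seq-∑ (λ i → if b i then 0ℝ else v i) k)
  (sum-cong-≗ (λ i → if-float (λ z → seq z k) (b i)))

seq-∑≠ : ∀ (x y : Input n) v k → seq (∑≠ x y v) k ≡ sum≠ x y (λ i → seq (v i) k)
seq-∑≠ x y v k = seq-∑-if (λ i → does (lookup x i ≟ lookup y i)) v k

seq-maxOver : ∀ (g : Input n → ℝ) k → seq (maxOver _⊔_ g) k ≡ maxOver ℚ._⊔_ (λ x → seq (g x) k)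
seq-maxOver {zero}  g k = refl
seq-maxOver {suc n} g k =
  cong₂ ℚ._⊔_ (seq-maxOver (g ∘ (false ∷_)) k) (seq-maxOver (g ∘ (true ∷_)) k)

maxOver-upper : ∀ {A : Set} (_∨_ : A → A → A) (_≼_ : A → A → Set) →
  (∀ {a b c} → a ≼ b → b ≼ c → a ≼ c) → (∀ {a} → a ≼ a) →
  (∀ a b → a ≼ (a ∨ b)) → (∀ a b → b ≼ (a ∨ b)) →
  (g : Input n → A) → ∀ x → g x ≼ maxOver _∨_ g
maxOver-upper _∨_ _≼_ ≼-trans ≼-refl left right g []          = ≼-refl
maxOver-upper _∨_ _≼_ ≼-trans ≼-refl left right g (false ∷ x) =
  ≼-trans (maxOver-upper _∨_ _≼_ ≼-trans ≼-refl left right (g ∘ (false ∷_)) x) (left _ _)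
maxOver-upper _∨_ _≼_ ≼-trans ≼-refl left right g (true ∷ x)  =
  ≼-trans (maxOver-upper _∨_ _≼_ ≼-trans ≼-refl left right (g ∘ (true ∷_)) x) (right _ _)

maxOver-least : ∀ (g : Input n → ℚ) {p} → (∀ x → g x ℚ.≤ p) → maxOver ℚ._⊔_ g ℚ.≤ p
maxOver-least {zero}  g g≤p = g≤p []
maxOver-least {suc n} g g≤p =
  ℚ.⊔-lub (maxOver-least (g ∘ (false ∷_)) (g≤p ∘ (false ∷_)))
          (maxOver-least (g ∘ (true ∷_)) (g≤p ∘ (true ∷_)))

0<½ε : ∀ {ε} → 0ℚ ℚ.< ε → 0ℚ ℚ.< ½ ℚ.* ε
0<½ε {ε} 0<ε = ℚ.positive⁻¹ _ {{ℚ.pos*pos⇒pos ½ ε {{ℚ.positive 0<ε}}}}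

≤ℝ-trans : ∀ {x y z} → x ≤ y → y ≤ z → x ≤ z
≤ℝ-trans {x} {y} {z} x≤y y≤z ε 0<ε = eventually-map
  (λ k (x≤ , y≤) → ≤-by-difference (0≤p+q (p≤q⇒0≤q-p x≤) (p≤q⇒0≤q-p y≤))
    (solve 4 (λ x y z e → x :+ (((y :+ con ½ :* e) :- x) :+ ((z :+ con ½ :* e) :- y)) := z :+ e)
      refl (seq x k) (seq y k) (seq z k) ε))
  (x≤y (½ ℚ.* ε) (0<½ε 0<ε) ⟨×⟩ y≤z (½ ℚ.* ε) (0<½ε 0<ε))

p≤p+ε : ∀ {p q ε} → 0ℚ ℚ.< ε → p ℚ.≤ q → p ℚ.≤ q ℚ.+ ε
p≤p+ε {p} {q} {ε} 0<ε p≤q = subst (ℚ._≤ q ℚ.+ ε) (ℚ.+-identityʳ p) (ℚ.+-mono-≤ p≤q (ℚ.<⇒≤ 0<ε))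

eventually-≤⇒≤ : ∀ x y → Eventually (λ k → seq x k ℚ.≤ seq y k) → x ≤ y
eventually-≤⇒≤ x y x≤y ε 0<ε = eventually-map (λ k → p≤p+ε 0<ε) x≤y

-- The nested form lets an index m be fixed first and its term still be compared with all
-- sufficiently late ones.
cauchy-≤ : ∀ x {δ} → 0ℚ ℚ.< δ → Eventually (λ m → Eventually (λ k → seq x m ℚ.≤ seq x k ℚ.+ δ))
cauchy-≤ x {δ} 0<δ =
  let N , close = cauchy x δ 0<δ
  in N , λ m N≤m → N , λ k N≤k →
    ≤-by-difference (p≤q⇒0≤q-p (ℚ.≤-trans (p≤∣p∣ (seq x m ℚ.- seq x k)) (ℚ.<⇒≤ (close m k N≤m N≤k))))
      (solve 3 (λ p q d → p :+ (d :- (p :- q)) := q :+ d) refl (seq x m) (seq x k) δ)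
  where
  p≤∣p∣ : ∀ p → p ℚ.≤ ℚ.∣ p ∣
  p≤∣p∣ p with ℚ.≤-total 0ℚ p
  ... | inj₁ 0≤p = ℚ.≤-reflexive (sym (ℚ.0≤p⇒∣p∣≡p 0≤p))
  ... | inj₂ p≤0 = ℚ.≤-trans p≤0 (ℚ.0≤∣p∣ p)

module _ {f : BoolFun n} where

  certificates⇒FCFeasible : ∀ {S} (C : Certificates f S) x →
    FCFeasible f x (λ i → fromℚ (Certificates.weight C x i))
  certificates⇒FCFeasible C x = record
    { nonneg = λ i → eventually-≤⇒≤ 0ℝ (fromℚ (Certificates.weight C x i)) (always λ k → Certificates.nonneg C x i)
    ; covers = λ y fy≢fx → eventually-≤⇒≤ 1ℝ (∑≠ x y (λ i → fromℚ (Certificates.weight C x i))) (always λ k →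
        subst (1ℚ ℚ.≤_) (sym (seq-∑≠ x y (λ i → fromℚ (Certificates.weight C x i)) k))
          (Certificates.covers C x y fy≢fx))
    }

  FC≤ : ∀ {S fc} → Certificates f S → IsFC f fc → fc ≤ fromℚ S
  FC≤ {S} {fc} C (g , g-optimal , fc≤max , _) = ≤ℝ-trans {fc} {maxOver _⊔_ g} {fromℚ S} fc≤max
    λ ε 0<ε → eventually-map
      (λ k g≤ → subst (ℚ._≤ S ℚ.+ ε) (sym (seq-maxOver g k))
        (maxOver-least (λ x → seq (g x) k) λ x → ℚ.≤-trans (g≤ x) (ℚ.+-monoˡ-≤ ε
          (ℚ.≤-trans (ℚ.≤-reflexive (seq-∑ (λ i → fromℚ (Certificates.weight C x i)) k))
            (Certificates.total C x)))))
      (eventually-∀Input (λ x → proj₁ (g-optimal x) _ (certificates⇒FCFeasible C x) ε 0<ε))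

  expectational⇒ECFeasible : ∀ {T} (C : ExpectationalCertificates f T) →
    ECFeasible f (λ x i → fromℚ (ExpectationalCertificates.weight C x i))
  expectational⇒ECFeasible C = record
    { nonneg = λ x i → eventually-≤⇒≤ 0ℝ (fromℚ (weight x i)) (always λ k → nonneg x i)
    ; ≤one   = λ x i → eventually-≤⇒≤ (fromℚ (weight x i)) 1ℝ (always λ k → ≤one x i)
    ; covers = λ x y fx≢fy → eventually-≤⇒≤ 1ℝ
        (∑≠ x y (λ i → fromℚ (weight x i) * fromℚ (weight y i))) (always λ k → subst (1ℚ ℚ.≤_)
        (sym (seq-∑≠ x y (λ i → fromℚ (weight x i) * fromℚ (weight y i)) k)) (covers x y fx≢fy))
    }
    where open ExpectationalCertificates C

  EC≤ : ∀ {T ec} → ExpectationalCertificates f T → IsEC f ec → ec ≤ fromℚ T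
  EC≤ {T} {ec} C (lower , _) =
    ≤ℝ-trans {ec} {maxOver _⊔_ (λ x → ∑ (w x))} {fromℚ T} (lower w (expectational⇒ECFeasible C))
      (eventually-≤⇒≤ (maxOver _⊔_ (λ x → ∑ (w x))) (fromℚ T) (always λ k → subst (ℚ._≤ T) (sym (seq-maxOver (λ x → ∑ (w x)) k))
        (maxOver-least (λ x → seq (∑ (w x)) k) λ x →
          ℚ.≤-trans (ℚ.≤-reflexive (seq-∑ (w x) k)) (ExpectationalCertificates.total C x))))
    where
    w : Input n → Vector ℝ n
    w x i = fromℚ (ExpectationalCertificates.weight C x i)

  -- The sequences of nearly optimal real certificates are frozen at one index,
  -- at which all their defining inequalities hold up to a small error; adding
  -- ε and rescaling makes up for the error.
  FC⇒certificates : ∀ {fc} → IsFC f fc →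
    ∃[ S ] (Certificates f S × Eventually (λ k → S ℚ.≤ 4/3ℚ ℚ.* (seq fc k ℚ.+ 1/4ℚ)))
  FC⇒certificates {fc} (g , g-optimal , _ , max≤fc) =
    S , record
      { weight = weight
      ; nonneg = λ x i → 0≤p*q (ℚ.nonNegative⁻¹ 4/3ℚ) (nonneg x i)
      ; covers = λ x y fy≢fx → ℚ.≤-trans (scale-covers {sum≠ x y (v x)} (covers x y fy≢fx))
          (ℚ.≤-trans (ℚ.*-monoˡ-≤-nonNeg 4/3ℚ (sum≠-mono x y {v x} (λ i _ → p≤p+ε 0<ε ℚ.≤-refl)))
            (ℚ.≤-reflexive (sym (sum≠-* x y 4/3ℚ (λ i → v x i ℚ.+ ε)))))
      ; total  = λ x → ℚ.≤-trans (ℚ.≤-reflexive (trans (sym (*-distribˡ-sum 4/3ℚ (λ i → v x i ℚ.+ ε)))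
            (cong (4/3ℚ ℚ.*_) (∑-distrib-+ (v x) (λ _ → ε)))))
          (ℚ.*-monoˡ-≤-nonNeg 4/3ℚ (ℚ.+-mono-≤ (total x) ∑ε≤))
      } , eventually-map (λ k (max≤ , ≤fc) → S≤ {q = seq fc k} max≤ ≤fc) (stable ⟨×⟩ max≤fc 1/16ℚ (ℚ.positive⁻¹ 1/16ℚ))
    where
    near-optimal : ∀ x → ∃[ v ] (FCFeasible f x v × ∑ v < g x + fromℚ 1/16ℚ)
    near-optimal x = proj₂ (g-optimal x) (fromℚ 1/16ℚ)
      (1/16ℚ , ℚ.positive⁻¹ 1/16ℚ , always λ _ → ℚ.≤-refl)

    certificate : Input n → Vector ℝ n
    certificate x = proj₁ (near-optimal x)

    ε,0<ε,∑ε≤ = small-constant n (ℚ.positive⁻¹ 1/16ℚ)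
    ε    = proj₁ ε,0<ε,∑ε≤
    0<ε  = proj₁ (proj₂ ε,0<ε,∑ε≤)
    ∑ε≤ = proj₂ (proj₂ ε,0<ε,∑ε≤)

    good : Eventually (λ k →
      (∀ x i → 0ℚ ℚ.≤ seq (certificate x i) k ℚ.+ ε) ×
      (∀ x y → f y ≢ f x → 1ℚ ℚ.≤ sum≠ x y (λ i → seq (certificate x i) k) ℚ.+ 1/4ℚ) ×
      (∀ x → sum (λ i → seq (certificate x i) k) ℚ.≤ seq (maxOver _⊔_ g) k ℚ.+ 1/16ℚ) ×
      Eventually (λ m → seq (maxOver _⊔_ g) k ℚ.≤ seq (maxOver _⊔_ g) m ℚ.+ 1/16ℚ))
    good =
      eventually-∀Input (λ x → eventually-∀Fin λ i →
        FCFeasible.nonneg (feasible x) i ε 0<ε) ⟨×⟩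
      eventually-∀Input (λ x → eventually-∀Input λ y → covers x y) ⟨×⟩
      eventually-∀Input (λ x → eventually-map (λ k → total x k) (proj₂ (proj₂ (proj₂ (proj₂ (near-optimal x)))))) ⟨×⟩
      cauchy-≤ (maxOver _⊔_ g) (ℚ.positive⁻¹ 1/16ℚ)
      where
      feasible : ∀ x → FCFeasible f x (certificate x)
      feasible x = proj₁ (proj₂ (near-optimal x))

      covers : ∀ x y → Eventually (λ k →
        f y ≢ f x → 1ℚ ℚ.≤ sum≠ x y (λ i → seq (certificate x i) k) ℚ.+ 1/4ℚ)
      -- The index has to be chosen before `f y ≢ f x` is supplied, so the values are compared
      -- first.
      covers x y with f y ≟ f x
      ... | yes fy≡fx = always λ k fy≢fx → contradiction fy≡fx fy≢fx
      ... | no  fy≢fx = eventually-map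
        (λ k 1≤ _ → subst (λ z → 1ℚ ℚ.≤ z ℚ.+ 1/4ℚ) (seq-∑≠ x y (certificate x) k) 1≤)
        (FCFeasible.covers (feasible x) y fy≢fx 1/4ℚ (ℚ.positive⁻¹ 1/4ℚ))

      total : ∀ x k →
        seq (∑ (certificate x)) k ℚ.+ proj₁ (proj₂ (proj₂ (near-optimal x))) ℚ.≤ seq (g x) k ℚ.+ 1/16ℚ →
        sum (λ i → seq (certificate x i) k) ℚ.≤ seq (maxOver _⊔_ g) k ℚ.+ 1/16ℚ
      total x k ≤g = ℚ.≤-trans
        (p≤p+ε (proj₁ (proj₂ (proj₂ (proj₂ (near-optimal x))))) (ℚ.≤-reflexive (sym (seq-∑ (certificate x) k))))
        (ℚ.≤-trans ≤g (ℚ.+-monoˡ-≤ 1/16ℚ (subst (seq (g x) k ℚ.≤_) (sym (seq-maxOver g k))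
          (maxOver-upper ℚ._⊔_ ℚ._≤_ ℚ.≤-trans ℚ.≤-refl ℚ.p≤p⊔q ℚ.p≤q⊔p (λ x → seq (g x) k) x))))

    N = proj₁ good
    at-N = proj₂ good N ℕ.≤-refl
    nonneg = proj₁ at-N
    covers = proj₁ (proj₂ at-N)
    total  = proj₁ (proj₂ (proj₂ at-N))
    stable = proj₂ (proj₂ (proj₂ at-N))

    v weight : Input n → Vector ℚ n
    v x i = seq (certificate x i) N
    weight x i = 4/3ℚ ℚ.* (v x i ℚ.+ ε)

    S : ℚ
    -- One 1/16 is for near-optimality and one for the sum of the added `ε`. In `S≤`, the drift of
    -- the maximum after `N` and its comparison with `fc` cost 1/16 each, which makes 1/4 in all.
    S = 4/3ℚ ℚ.* ((seq (maxOver _⊔_ g) N ℚ.+ 1/16ℚ) ℚ.+ 1/16ℚ)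

    S≤ : ∀ {p q} → seq (maxOver _⊔_ g) N ℚ.≤ p ℚ.+ 1/16ℚ → p ℚ.≤ q ℚ.+ 1/16ℚ →
         S ℚ.≤ 4/3ℚ ℚ.* (q ℚ.+ 1/4ℚ)
    S≤ {p} {q} max≤p p≤q = ℚ.*-monoˡ-≤-nonNeg 4/3ℚ
      (≤-by-difference {(seq (maxOver _⊔_ g) N ℚ.+ 1/16ℚ) ℚ.+ 1/16ℚ} (0≤p+q (p≤q⇒0≤q-p max≤p) (p≤q⇒0≤q-p p≤q))
        (solve 3 (λ m p q → ((m :+ con 1/16ℚ) :+ con 1/16ℚ) :+ (((p :+ con 1/16ℚ) :- m) :+ ((q :+ con 1/16ℚ) :- p))
            := q :+ con 1/4ℚ)
          refl (seq (maxOver _⊔_ g) N) p q))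

    scale-covers : ∀ {p} → 1ℚ ℚ.≤ p ℚ.+ 1/4ℚ → 1ℚ ℚ.≤ 4/3ℚ ℚ.* p
    scale-covers {p} 1≤ = ≤-by-difference (0≤p*q (ℚ.nonNegative⁻¹ 4/3ℚ) (p≤q⇒0≤q-p 1≤))
      (solve 1 (λ p → con 1ℚ :+ con 4/3ℚ :* ((p :+ con 1/4ℚ) :- con 1ℚ) := con 4/3ℚ :* p) refl p)

-- Randomized algorithms

unit : Fin n → Vector ℚ n
unit zero    zero    = 1ℚ
unit zero    (suc j) = 0ℚ
unit (suc i) zero    = 0ℚ
unit (suc i) (suc j) = unit i j

unit-nonneg : ∀ (i j : Fin n) → 0ℚ ℚ.≤ unit i j
unit-nonneg zero    zero    = ℚ.nonNegative⁻¹ 1ℚ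
unit-nonneg zero    (suc j) = ℚ.≤-refl
unit-nonneg (suc i) zero    = ℚ.≤-refl
unit-nonneg (suc i) (suc j) = unit-nonneg i j

sum-unit : ∀ (i : Fin n) → sum (unit i) ≡ 1ℚ
sum-unit {suc n} zero    = cong (1ℚ ℚ.+_) (sum-replicate-zero n)
sum-unit {suc n} (suc i) = trans (ℚ.+-identityˡ (sum (unit i))) (sum-unit i)

unit-self : ∀ (i : Fin n) → unit i i ≡ 1ℚ
unit-self zero    = refl
unit-self (suc i) = unit-self i

term≤sum : ∀ {u : Vector ℚ n} → (∀ i → 0ℚ ℚ.≤ u i) → ∀ i → u i ℚ.≤ sum u
term≤sum {suc n} {u} 0≤u zero = ≤-by-difference
  (subst (ℚ._≤ sum (u ∘ suc)) (sum-replicate-zero n) (sum-mono (0≤u ∘ suc))) refl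
term≤sum {suc n} {u} 0≤u (suc i) = ℚ.≤-trans (term≤sum (0≤u ∘ suc) i)
  (≤-by-difference (0≤u zero) (ℚ.+-comm (sum (u ∘ suc)) (u zero)))

sum≠-unit : ∀ (x y : Input n) i → lookup x i ≢ lookup y i → 1ℚ ℚ.≤ sum≠ x y (unit i)
sum≠-unit x y i x≢y = ℚ.≤-trans (ℚ.≤-reflexive (sym at-i))
  (term≤sum (λ j → nonneg (does (lookup x j ≟ lookup y j)) j) i)
  where
  nonneg : ∀ b j → 0ℚ ℚ.≤ (if b then 0ℚ else unit i j)
  nonneg true  j = ℚ.≤-refl
  nonneg false j = unit-nonneg i j
  at-i : (if does (lookup x i ≟ lookup y i) then 0ℚ else unit i i) ≡ 1ℚ
  at-i rewrite dec-false (lookup x i ≟ lookup y i) x≢y = unit-self i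

-- Repeated queries are counted with multiplicity, so the entries add up to exactly the number of
-- queries.
queryCount : DecisionTree n → Input n → Vector ℚ n
queryCount (leaf b)        x j = 0ℚ
queryCount (query i t₀ t₁) x j =
  unit i j ℚ.+ (if lookup x i then queryCount t₁ x j else queryCount t₀ x j)

queryCount-nonneg : ∀ t (x : Input n) j → 0ℚ ℚ.≤ queryCount t x j
queryCount-nonneg (leaf b)        x j = ℚ.≤-refl
queryCount-nonneg (query i t₀ t₁) x j = 0≤p+q (unit-nonneg i j) (branch (lookup x i))
  where
  branch : ∀ b → 0ℚ ℚ.≤ (if b then queryCount t₁ x j else queryCount t₀ x j)
  branch true  = queryCount-nonneg t₁ x j
  branch false = queryCount-nonneg t₀ x j

sum-queryCount : ∀ t (x : Input n) → sum (queryCount t x) ≡ + queries t x ℚ./ 1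
sum-queryCount {n} (leaf b)        x = sum-replicate-zero n
sum-queryCount {n} (query i t₀ t₁) x = trans
  (∑-distrib-+ (unit i) (λ j → if lookup x i then queryCount t₁ x j else queryCount t₀ x j))
  (trans (cong₂ ℚ._+_ (sum-unit i) (branch (lookup x i)))
    (sym (/1-suc (if lookup x i then queries t₁ x else queries t₀ x))))
  where
  branch : ∀ b → sum (λ j → if b then queryCount t₁ x j else queryCount t₀ x j) ≡
                 + (if b then queries t₁ x else queries t₀ x) ℚ./ 1
  branch true  = sum-queryCount t₁ x
  branch false = sum-queryCount t₀ x

-- The computations on x and y run along the same path until they query a coordinate where x and y
-- differ. If the outputs differ there is such a query, and it lies on the path of x.
queryCount-separates : ∀ t (x y : Input n) → output t x ≢ output t y →
                       1ℚ ℚ.≤ sum≠ x y (queryCount t x)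
queryCount-separates (leaf b)        x y differ = contradiction refl differ
queryCount-separates (query i t₀ t₁) x y differ with lookup x i ≟ lookup y i
... | no x≢y = ℚ.≤-trans (sum≠-unit x y i x≢y) (sum≠-mono x y λ j _ →
  ≤-by-difference (branch (lookup x i) j) refl)
  where
  branch : ∀ b j → 0ℚ ℚ.≤ (if b then queryCount t₁ x j else queryCount t₀ x j)
  branch true  = queryCount-nonneg t₁ x
  branch false = queryCount-nonneg t₀ x
... | yes x≡y = ℚ.≤-trans (branch (lookup x i) (lookup y i) x≡y differ) (sum≠-mono x y λ j _ →
  ≤-by-difference (unit-nonneg i j) (ℚ.+-comm _ (unit i j)))
  where
  branch : ∀ a b → a ≡ b →
    (if a then output t₁ x else output t₀ x) ≢ (if b then output t₁ y else output t₀ y) →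
    1ℚ ℚ.≤ sum≠ x y (λ j → if a then queryCount t₁ x j else queryCount t₀ x j)
  branch true  true  _ = queryCount-separates t₁ x y
  branch false false _ = queryCount-separates t₀ x y

sum≠-sum : ∀ {m} (x y : Input n) (u : Fin m → Vector ℚ n) →
  sum≠ x y (λ i → sum λ r → u r i) ≡ sum (λ r → sum≠ x y (u r))
sum≠-sum {m = m} x y u = trans
  (sum-cong-≗ (λ i → inside (does (lookup x i ≟ lookup y i)) i))
  (∑-comm (λ i r → if does (lookup x i ≟ lookup y i) then 0ℚ else u r i))
  where
  inside : ∀ b i → (if b then 0ℚ else sum λ r → u r i) ≡ sum (λ r → if b then 0ℚ else u r i)
  inside true  i = sym (sum-replicate-zero m)
  inside false i = refl

foldr-⊔-upper : ∀ {m} (g : Vector ℕ m) i → g i ℕ.≤ foldr ℕ._⊔_ 0 g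
foldr-⊔-upper {suc m} g zero    = ℕ.m≤m⊔n (g zero) _
foldr-⊔-upper {suc m} g (suc i) = ℕ.≤-trans (foldr-⊔-upper (g ∘ suc) i) (ℕ.m≤n⊔m (g zero) _)

queries≤worstCase : ∀ (A : RandomizedAlgorithm n) r x → queries (tree A r) x ℕ.≤ worstCase A
queries≤worstCase A r x = ℕ.≤-trans
  (maxOver-upper ℕ._⊔_ ℕ._≤_ ℕ.≤-trans ℕ.≤-refl ℕ.m≤m⊔n ℕ.m≤n⊔m (queries (tree A r)) x)
  (foldr-⊔-upper (λ r → maxOver ℕ._⊔_ (queries (tree A r))) r)

module QueryProbabilities {f : BoolFun n} (A : RandomizedAlgorithm n) (computes : Computes A f) where

  private
    δ 1/3ℚ : ℚ
    -- Chosen so that 1/3 - 5δ = 1/4, the margin left in `∑separation≥`.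
    δ    = + 1 ℚ./ 60
    1/3ℚ = + 1 ℚ./ 3

    correct : Input n → Fin (size A) → Bool
    correct x r = does (output (tree A r) x ≟ f x)

    ε,0<ε,∑ε≤ = small-constant (size A) {δ} (ℚ.positive⁻¹ δ)
    ε    = proj₁ ε,0<ε,∑ε≤
    0<ε  = proj₁ (proj₂ ε,0<ε,∑ε≤)
    ∑ε≤  = proj₂ (proj₂ ε,0<ε,∑ε≤)

    good : Eventually (λ k →
      (∀ r → 0ℚ ℚ.≤ seq (prob A r) k ℚ.+ ε) ×
      sum (λ r → seq (prob A r) k) ℚ.≤ 1ℚ ℚ.+ δ ×
      1ℚ ℚ.≤ sum (λ r → seq (prob A r) k) ℚ.+ δ ×
      (∀ x → sum (λ r → if correct x r then 0ℚ else seq (prob A r) k) ℚ.≤ 1/3ℚ ℚ.+ δ))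
    good =
      eventually-∀Fin (λ r → prob≥0 A r ε 0<ε) ⟨×⟩
      eventually-map (λ k → subst (ℚ._≤ 1ℚ ℚ.+ δ) (seq-∑ (prob A) k))
        (proj₁ (prob-sum A) δ (ℚ.positive⁻¹ δ)) ⟨×⟩
      eventually-map (λ k → subst (λ z → 1ℚ ℚ.≤ z ℚ.+ δ) (seq-∑ (prob A) k))
        (proj₂ (prob-sum A) δ (ℚ.positive⁻¹ δ)) ⟨×⟩
      eventually-∀Input (λ x → eventually-map
        (λ k → subst (ℚ._≤ 1/3ℚ ℚ.+ δ) (seq-∑-if (correct x) (prob A) k))
        (computes x δ (ℚ.positive⁻¹ δ)))

    N = proj₁ good
    at-N = proj₂ good N ℕ.≤-refl

    -- The probabilities are frozen at index `N`, where they may be slightly negative; `p⁺` shifts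
    -- them to nonnegative weights whose sum is only approximately 1.
    p p⁺ : Vector ℚ (size A)
    p r = seq (prob A r) N
    p⁺ r = p r ℚ.+ ε

    p⁺-nonneg : ∀ r → 0ℚ ℚ.≤ p⁺ r
    p⁺-nonneg = proj₁ at-N

    ∑p⁺≤ : sum p⁺ ℚ.≤ (1ℚ ℚ.+ δ) ℚ.+ δ
    ∑p⁺≤ = ℚ.≤-trans (ℚ.≤-reflexive (∑-distrib-+ p (λ _ → ε)))
      (ℚ.+-mono-≤ (proj₁ (proj₂ at-N)) ∑ε≤)

    ≤∑p⁺ : 1ℚ ℚ.≤ sum p⁺ ℚ.+ δ
    ≤∑p⁺ = ℚ.≤-trans (proj₁ (proj₂ (proj₂ at-N)))
      (ℚ.+-monoˡ-≤ δ (sum-mono {u = p} {p⁺} (λ r → p≤p+ε 0<ε ℚ.≤-refl)))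

    error : Input n → Vector ℚ (size A)
    error x r = if correct x r then 0ℚ else p⁺ r

    error≤ : ∀ x → sum (error x) ℚ.≤ (1/3ℚ ℚ.+ δ) ℚ.+ δ
    error≤ x = ℚ.≤-trans (sum-mono (λ r → termwise (correct x r) r))
      (ℚ.≤-trans (ℚ.≤-reflexive (∑-distrib-+ (λ r → if correct x r then 0ℚ else p r) (λ _ → ε)))
        (ℚ.+-mono-≤ (proj₂ (proj₂ (proj₂ at-N)) x) ∑ε≤))
      where
      termwise : ∀ b r → (if b then 0ℚ else p⁺ r) ℚ.≤ (if b then 0ℚ else p r) ℚ.+ ε
      termwise true  r = p≤p+ε 0<ε ℚ.≤-refl
      termwise false r = ℚ.≤-refl

    separation : Input n → Input n → Vector ℚ (size A)
    separation x y r = p⁺ r ℚ.* sum≠ x y (queryCount (tree A r) x)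

    separation-nonneg : ∀ x y r → 0ℚ ℚ.≤ separation x y r
    separation-nonneg x y r = 0≤p*q (p⁺-nonneg r)
      (ℚ.≤-trans (ℚ.≤-reflexive (sym (sum≠-zero x y)))
        (sum≠-mono x y (λ i _ → queryCount-nonneg (tree A r) x i)))
      where
      sum≠-zero : ∀ (x y : Input n) → sum≠ x y (λ _ → 0ℚ) ≡ 0ℚ
      sum≠-zero x y = trans (sum-cong-≗ (λ i → zero-if (does (lookup x i ≟ lookup y i)))) (sum-replicate-zero n)
        where
        zero-if : ∀ b → (if b then 0ℚ else 0ℚ) ≡ 0ℚ
        zero-if true  = refl
        zero-if false = refl

    -- If a tree queries no difference of x and y then it errs on one of them.
    separates-or-errs : ∀ x y → f x ≢ f y → ∀ r →
      p⁺ r ℚ.≤ separation x y r ℚ.+ (error x r ℚ.+ error y r)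
    separates-or-errs x y fx≢fy r = cases (output (tree A r) x ≟ f x) (output (tree A r) y ≟ f y)
      (p⁺-nonneg r) (separation-nonneg x y r) λ x✓ y✓ →
        subst (ℚ._≤ separation x y r) (ℚ.*-identityʳ (p⁺ r))
          (ℚ.*-monoˡ-≤-nonNeg (p⁺ r) {{ℚ.nonNegative (p⁺-nonneg r)}}
            (queryCount-separates (tree A r) x y (λ eq → fx≢fy (trans (sym x✓) (trans eq y✓)))))
      where
      cases : ∀ {P Q : Set} {p s} (P? : Dec P) (Q? : Dec Q) → 0ℚ ℚ.≤ p → 0ℚ ℚ.≤ s →
        (P → Q → p ℚ.≤ s) →
        p ℚ.≤ s ℚ.+ ((if does P? then 0ℚ else p) ℚ.+ (if does Q? then 0ℚ else p))
      cases {p = p} {s} (yes x✓) (yes y✓) 0≤p 0≤s p≤s =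
        ℚ.≤-trans (p≤s x✓ y✓) (ℚ.≤-reflexive (sym (ℚ.+-identityʳ s)))
      cases {p = p} {s} (yes _) (no _) 0≤p 0≤s _ = ≤-by-difference 0≤s
        (solve 2 (λ p s → p :+ s := s :+ (con 0ℚ :+ p)) refl p s)
      cases {p = p} {s} (no _) (yes _) 0≤p 0≤s _ = ≤-by-difference 0≤s
        (solve 2 (λ p s → p :+ s := s :+ (p :+ con 0ℚ)) refl p s)
      cases {p = p} {s} (no _) (no _) 0≤p 0≤s _ = ≤-by-difference (0≤p+q 0≤s 0≤p)
        (solve 2 (λ p s → p :+ (s :+ p) := s :+ (p :+ p)) refl p s)

    -- The weights `p⁺` sum to at least 1 - δ, and the errors on x and on y take away at most 1/3 +
    -- 2δ each. What remains for the separating trees is at least 1/3 - 5δ = 1/4.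
    ∑separation≥ : ∀ x y → f x ≢ f y → 1ℚ ℚ.≤ 4ℚ ℚ.* sum (separation x y)
    ∑separation≥ x y fx≢fy = ≤-by-difference
      (0≤p*q (ℚ.nonNegative⁻¹ 4ℚ) (0≤p+q (0≤p+q (p≤q⇒0≤q-p ≤∑p⁺) (p≤q⇒0≤q-p ∑p⁺≤∑))
        (0≤p+q (p≤q⇒0≤q-p (error≤ x)) (p≤q⇒0≤q-p (error≤ y)))))
      (solve 4 (λ P s a b →
          con 1ℚ :+ con 4ℚ :* ((((P :+ con δ) :- con 1ℚ) :+ ((s :+ (a :+ b)) :- P)) :+
            ((((con 1/3ℚ :+ con δ) :+ con δ) :- a) :+ (((con 1/3ℚ :+ con δ) :+ con δ) :- b)))
          := con 4ℚ :* s)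
        refl (sum p⁺) (sum (separation x y)) (sum (error x)) (sum (error y)))
      where
      ∑p⁺≤∑ : sum p⁺ ℚ.≤ sum (separation x y) ℚ.+ (sum (error x) ℚ.+ sum (error y))
      ∑p⁺≤∑ = ℚ.≤-trans (sum-mono (separates-or-errs x y fx≢fy))
        (ℚ.≤-reflexive (trans
          (∑-distrib-+ (separation x y) (λ r → error x r ℚ.+ error y r))
          (cong (sum (separation x y) ℚ.+_) (∑-distrib-+ (error x) (error y)))))

    expectedCount : Input n → Vector ℚ n
    expectedCount x i = sum λ r → p⁺ r ℚ.* queryCount (tree A r) x i

    d : ℚ
    d = + worstCase A ℚ./ 1

    total : ∀ x → sum (expectedCount x) ℚ.≤ sum p⁺ ℚ.* d
    total x = begin
      sum (expectedCount x)
        ≡⟨ ∑-comm (λ i r → p⁺ r ℚ.* queryCount (tree A r) x i) ⟩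
      sum (λ r → sum λ i → p⁺ r ℚ.* queryCount (tree A r) x i)
        ≤⟨ sum-mono {u = λ r → sum λ i → p⁺ r ℚ.* queryCount (tree A r) x i} (λ r → ℚ.≤-trans
             (ℚ.≤-reflexive (trans (sym (*-distribˡ-sum (p⁺ r) (queryCount (tree A r) x)))
               (cong (p⁺ r ℚ.*_) (sum-queryCount (tree A r) x))))
             (ℚ.*-monoˡ-≤-nonNeg (p⁺ r) {{ℚ.nonNegative (p⁺-nonneg r)}}
               (/1-mono-≤ (queries≤worstCase A r x)))) ⟩
      sum (λ r → p⁺ r ℚ.* d)
        ≡⟨ *-distribʳ-sum d p⁺ ⟨
      sum p⁺ ℚ.* d ∎
      where open ℚ.≤-Reasoning

  certificates : Certificates f (+ 5 ℚ./ 1 ℚ.* (+ worstCase A ℚ./ 1))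
  certificates = record
    { weight = λ x i → 4ℚ ℚ.* expectedCount x i
    ; nonneg = λ x i → 0≤p*q (ℚ.nonNegative⁻¹ 4ℚ) (ℚ.≤-trans
        (ℚ.≤-reflexive (sym (sum-replicate-zero (size A))))
        (sum-mono (λ r → 0≤p*q (p⁺-nonneg r) (queryCount-nonneg (tree A r) x i))))
    ; covers = λ x y fy≢fx → ℚ.≤-trans (∑separation≥ x y (fy≢fx ∘ sym)) (ℚ.≤-reflexive (sym (exchange x y)))
    ; total  = λ x → ℚ.≤-trans (ℚ.≤-reflexive (sym (*-distribˡ-sum 4ℚ (expectedCount x))))
        -- The total is at most 4(1 + 2δ)d = (62/15)d, and 13/15 is what is missing to 5.
        (≤-by-difference {r = 4ℚ ℚ.* (sum p⁺ ℚ.* d ℚ.- sum (expectedCount x)) ℚ.+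
                              (4ℚ ℚ.* ((((1ℚ ℚ.+ δ) ℚ.+ δ) ℚ.- sum p⁺) ℚ.* d) ℚ.+ + 13 ℚ./ 15 ℚ.* d)}
          (0≤p+q (0≤p*q (ℚ.nonNegative⁻¹ 4ℚ) (p≤q⇒0≤q-p (total x)))
            (0≤p+q (0≤p*q (ℚ.nonNegative⁻¹ 4ℚ) (0≤p*q (p≤q⇒0≤q-p ∑p⁺≤) (0≤/1 (worstCase A))))
              (0≤p*q (ℚ.nonNegative⁻¹ (+ 13 ℚ./ 15)) (0≤/1 (worstCase A)))))
          (solve 3 (λ s P d → con 4ℚ :* s :+ (con 4ℚ :* (P :* d :- s) :+
              (con 4ℚ :* ((((con 1ℚ :+ con δ) :+ con δ) :- P) :* d) :+ con (+ 13 ℚ./ 15) :* d))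
              := con (+ 5 ℚ./ 1) :* d)
            refl (sum (expectedCount x)) (sum p⁺) d))
    }
    where
    exchange : ∀ x y → sum≠ x y (λ i → 4ℚ ℚ.* expectedCount x i) ≡ 4ℚ ℚ.* sum (separation x y)
    exchange x y = trans (sum≠-* x y 4ℚ (expectedCount x)) (cong (4ℚ ℚ.*_)
      (trans (sum≠-sum x y (λ r i → p⁺ r ℚ.* queryCount (tree A r) x i))
        (sum-cong-≗ (λ r → sum≠-* x y (p⁺ r) (queryCount (tree A r) x)))))

-- Powers 3/2 and the constant

-- A negative p, which may occur as a term of the sequence of a nonnegative real, has p³ ≤ 0 ≤ q³.
cube-mono-≤ : ∀ {p q} → 0ℚ ℚ.≤ q → p ℚ.≤ q → p ℚ.* p ℚ.* p ℚ.≤ q ℚ.* q ℚ.* q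
cube-mono-≤ {p} {q} 0≤q p≤q with ℚ.≤-total 0ℚ p
... | inj₁ 0≤p = *-mono-≤ (0≤p*q 0≤p 0≤p) 0≤p (*-mono-≤ 0≤p 0≤p p≤q p≤q) p≤q
... | inj₂ p≤0 = ≤-by-difference
  (0≤p+q (0≤p*q (0≤p*q 0≤q 0≤q) 0≤q) (0≤p*q (0≤p² p) (p≤q⇒0≤q-p p≤0)))
  (solve 2 (λ p q → p :* p :* p :+ (q :* q :* q :+ (p :* p) :* (con 0ℚ :- p)) := q :* q :* q)
    refl p q)

½≤p⇒1≤8p³ : ∀ {p} → ½ ℚ.≤ p → 1ℚ ℚ.≤ + 8 ℚ./ 1 ℚ.* (p ℚ.* p ℚ.* p)
½≤p⇒1≤8p³ ½≤p = ℚ.*-monoˡ-≤-nonNeg (+ 8 ℚ./ 1)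
  (cube-mono-≤ {½} (ℚ.≤-trans (ℚ.nonNegative⁻¹ ½) ½≤p) ½≤p)

private
  -- 64 * 5³ = 8000 ≤ C and K² = 2 * C.
  C K : ℚ
  C = + 8192 ℚ./ 1
  K = + 128 ℚ./ 1

-- As b³ ≥ 1/8, an error of 1/16 in r² is absorbed by a factor of two.
≤-three-halves-power : ∀ {b r} → IsThreeHalvesPower b r → {t : ℕ → ℚ} →
  Eventually (λ k → ½ ℚ.≤ seq b k × t k ℚ.* t k ℚ.≤ C ℚ.* (seq b k ℚ.* seq b k ℚ.* seq b k)) →
  Eventually (λ k → t k ℚ.≤ K ℚ.* seq r k)
≤-three-halves-power {b} {r} (0≤r , _ , b³≤r²) {t} t²≤ = eventually-map
  (λ k ((½≤b , t²≤) , 0≤r+ , b³≤) → pointwise (seq b k) (seq r k) (t k) ½≤b t²≤ 0≤r+ b³≤)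
  (t²≤ ⟨×⟩ 0≤r 1/16ℚ (ℚ.positive⁻¹ 1/16ℚ) ⟨×⟩ b³≤r² 1/16ℚ (ℚ.positive⁻¹ 1/16ℚ))
  where
  pointwise : ∀ b r t → ½ ℚ.≤ b → t ℚ.* t ℚ.≤ C ℚ.* (b ℚ.* b ℚ.* b) → 0ℚ ℚ.≤ r ℚ.+ 1/16ℚ →
    b ℚ.* b ℚ.* b ℚ.≤ r ℚ.* r ℚ.+ 1/16ℚ → t ℚ.≤ K ℚ.* r
  pointwise b r t ½≤b t²≤ 0≤r+ b³≤ = square-cancel-≤ (0≤p*q (ℚ.nonNegative⁻¹ K) r≥0)
    (≤-by-difference
      (0≤p+q (p≤q⇒0≤q-p t²≤) (0≤p+q
        (0≤p*q (ℚ.nonNegative⁻¹ (+ 1024 ℚ./ 1)) (p≤q⇒0≤q-p 1≤8b³))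
        (0≤p*q (ℚ.nonNegative⁻¹ (C ℚ.+ C)) (p≤q⇒0≤q-p b³≤))))
      (solve 3 (λ t x r → t :* t :+ ((con C :* x :- t :* t) :+
          (con (+ 1024 ℚ./ 1) :* (con (+ 8 ℚ./ 1) :* x :- con 1ℚ) :+ con (C ℚ.+ C) :* ((r :* r :+ con 1/16ℚ) :- x)))
          := (con K :* r) :* (con K :* r))
        refl t (b ℚ.* b ℚ.* b) r))
    where
    1≤8b³ = ½≤p⇒1≤8p³ ½≤b

    1/16≤r² : 1/16ℚ ℚ.≤ r ℚ.* r
    1/16≤r² = ≤-by-difference
      (0≤p+q (p≤q⇒0≤q-p b³≤) (0≤p*q (ℚ.nonNegative⁻¹ (+ 1 ℚ./ 8)) (p≤q⇒0≤q-p 1≤8b³)))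
      (solve 2 (λ x r → con 1/16ℚ :+ (((r :* r :+ con 1/16ℚ) :- x) :+
          con (+ 1 ℚ./ 8) :* (con (+ 8 ℚ./ 1) :* x :- con 1ℚ)) := r :* r)
        refl (b ℚ.* b ℚ.* b) r)

    -- From r ≥ -1/16, the case r ≤ 0 would give r² ≤ 1/256, against r² ≥ 1/16.
    r≥0 : 0ℚ ℚ.≤ r
    r≥0 = case ℚ.≤-total 0ℚ r of λ
      { (inj₁ 0≤r) → 0≤r
      ; (inj₂ r≤0) → contradiction (ℚ.≤-trans 1/16≤r² (r²≤1/256 r≤0))
          (toWitnessFalse {a? = 1/16ℚ ℚ.≤? 1/16ℚ ℚ.* 1/16ℚ} _) }
      where
      -r≤1/16 : 0ℚ ℚ.- r ℚ.≤ 1/16ℚ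
      -r≤1/16 = ≤-by-difference 0≤r+ (solve 1 (λ r → (con 0ℚ :- r) :+ (r :+ con 1/16ℚ) := con 1/16ℚ) refl r)
      r²≤1/256 : r ℚ.≤ 0ℚ → r ℚ.* r ℚ.≤ 1/16ℚ ℚ.* 1/16ℚ
      r²≤1/256 r≤0 = ℚ.≤-trans
        (ℚ.≤-reflexive (solve 1 (λ r → r :* r := (con 0ℚ :- r) :* (con 0ℚ :- r)) refl r))
        (*-mono-≤ (p≤q⇒0≤q-p r≤0) (p≤q⇒0≤q-p r≤0) -r≤1/16 -r≤1/16)

≤-three-halves-power-≤0 : ∀ {x y} → x ≤ 0ℝ → IsThreeHalvesPower x y → y ≤ 0ℝ
≤-three-halves-power-≤0 {x} {y} x≤0 (_ , y²≤x³ , _) ε 0<ε = eventually-map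
  (λ k (x≤η , y²≤) → subst (seq y k ℚ.≤_) (sym (ℚ.+-identityˡ ε))
    (pointwise (seq x k) (seq y k) x≤η y²≤))
  (x≤0 η 0<η ⟨×⟩ y²≤x³ η 0<η)
  where
  0<ε² : 0ℚ ℚ.< ε ℚ.* ε
  0<ε² = ℚ.positive⁻¹ _ {{ℚ.pos*pos⇒pos ε {{ℚ.positive 0<ε}} ε {{ℚ.positive 0<ε}}}}

  η : ℚ
  -- Since η ≤ 1 and η ≤ ε²/2, a late term satisfies y² ≤ η³ + η ≤ 2η ≤ ε².
  η = ½ ℚ.* (ε ℚ.* ε) ℚ.⊓ 1ℚ

  0<η : 0ℚ ℚ.< η
  0<η = case ℚ.⊓-sel (½ ℚ.* (ε ℚ.* ε)) 1ℚ of λ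
    { (inj₁ η≡) → subst (0ℚ ℚ.<_) (sym η≡) (0<½ε 0<ε²)
    ; (inj₂ η≡) → subst (0ℚ ℚ.<_) (sym η≡) (ℚ.positive⁻¹ 1ℚ) }

  η³≤η : η ℚ.* η ℚ.* η ℚ.≤ η
  η³≤η = subst (η ℚ.* η ℚ.* η ℚ.≤_) (ℚ.*-identityˡ η)
    (*-mono-≤ (0≤p² η) 0≤η (*-mono-≤ {q = 1ℚ} {s = 1ℚ} 0≤η 0≤η η≤1 η≤1) ℚ.≤-refl)
    where
    0≤η = ℚ.<⇒≤ 0<η
    η≤1 = ℚ.p⊓q≤q (½ ℚ.* (ε ℚ.* ε)) 1ℚ

  pointwise : ∀ x y → x ℚ.≤ 0ℚ ℚ.+ η → y ℚ.* y ℚ.≤ x ℚ.* x ℚ.* x ℚ.+ η → y ℚ.≤ ε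
  pointwise x y x≤η y²≤ = square-cancel-≤ (ℚ.<⇒≤ 0<ε) (ℚ.≤-trans y²≤ (ℚ.≤-trans
    (ℚ.+-mono-≤ (ℚ.≤-trans (cube-mono-≤ (ℚ.<⇒≤ 0<η) (subst (x ℚ.≤_) (ℚ.+-identityˡ η) x≤η)) (ℚ.≤-trans η³≤η η≤½ε²)) η≤½ε²)
    (ℚ.≤-reflexive (solve 1 (λ e → con ½ :* (e :* e) :+ con ½ :* (e :* e) := e :* e) refl ε))))
    where
    η≤½ε² = ℚ.p⊓q≤p (½ ℚ.* (ε ℚ.* ε)) 1ℚ

0≤K*y : ∀ {x y} → IsThreeHalvesPower x y → 0ℝ ≤ fromℚ K * y
0≤K*y {y = y} (0≤y , _) ε 0<ε = eventually-map
  (λ k 0≤y+ → ≤-by-difference (0≤p*q (ℚ.nonNegative⁻¹ K) 0≤y+)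
    (solve 2 (λ y e → con 0ℚ :+ con K :* (y :+ con (+ 1 ℚ./ 128) :* e) := con K :* y :+ e)
      refl (seq y k) ε))
  (0≤y (+ 1 ℚ./ 128 ℚ.* ε) (ℚ.positive⁻¹ _ {{ℚ.pos*pos⇒pos (+ 1 ℚ./ 128) ε {{ℚ.positive 0<ε}}}}))

-- Constant functions and assembly of the three bounds

-- The construction of roots needs S ≥ 1, which a pair with different values forces; constant
-- functions are handled by zero weights. Comparing all values with the one at the all-false input
-- decides between the two.
constant-or-not : ∀ {n} (f : BoolFun n) → (∀ x y → f y ≡ f x) ⊎ (∃[ x ] ∃[ y ] f y ≢ f x)
constant-or-not {n} f with all-or-not f (f (replicate n false))
  where
  all-or-not : ∀ {n} (f : BoolFun n) b → (∀ x → f x ≡ b) ⊎ (∃[ x ] f x ≢ b)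
  all-or-not {zero} f b with f [] ≟ b
  ... | yes eq = inj₁ λ { [] → eq }
  ... | no neq = inj₂ ([] , neq)
  all-or-not {suc n} f b with all-or-not (f ∘ (false ∷_)) b | all-or-not (f ∘ (true ∷_)) b
  ... | inj₁ all₀      | inj₁ all₁      = inj₁ λ { (false ∷ x) → all₀ x ; (true ∷ x) → all₁ x }
  ... | inj₂ (x , neq) | _              = inj₂ (false ∷ x , neq)
  ... | inj₁ _         | inj₂ (x , neq) = inj₂ (true ∷ x , neq)
... | inj₁ all        = inj₁ λ x y → trans (all y) (sym (all x))
... | inj₂ (x , neq)  = inj₂ (replicate n false , x , neq)

nonconstant⇒1≤S : ∀ {f : BoolFun n} {S} → Certificates f S → ∀ x y → f y ≢ f x → 1ℚ ℚ.≤ S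
nonconstant⇒1≤S C x y fy≢fx = ℚ.≤-trans (covers x y fy≢fx) (ℚ.≤-trans (sum≠≤sum x y (nonneg x)) (total x))
  where open Certificates C

constant⇒certificates : ∀ {f : BoolFun n} → (∀ x y → f y ≡ f x) → Certificates f 0ℚ
constant⇒certificates {n} constant = record
  { weight = λ _ _ → 0ℚ
  ; nonneg = λ _ _ → ℚ.≤-refl
  ; covers = λ x y fy≢fx → contradiction (constant x y) fy≢fx
  ; total  = λ _ → ℚ.≤-reflexive (sum-replicate-zero n)
  }

constant⇒expectational : ∀ {f : BoolFun n} → (∀ x y → f y ≡ f x) → ExpectationalCertificates f 0ℚ
constant⇒expectational {n} constant = record
  { weight = λ _ _ → 0ℚ
  ; nonneg = λ _ _ → ℚ.≤-refl
  ; ≤one   = λ _ _ → ℚ.nonNegative⁻¹ 1ℚ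
  ; covers = λ x y fx≢fy → contradiction (constant y x) fx≢fy
  ; total  = λ _ → ℚ.≤-reflexive (sum-replicate-zero n)
  }

-- Common to both bounds on EC: b is FC(f) in one use and R(f) in the other. The comparison of S
-- with b is asked of late terms only, as b may be any real.
EC≤three-halves-power : ∀ {f : BoolFun n} {S ec b r} → 1ℚ ℚ.≤ S → Certificates f S → IsEC f ec →
  IsThreeHalvesPower b r → Eventually (λ k → ½ ℚ.≤ seq b k × S ℚ.≤ + 5 ℚ./ 1 ℚ.* seq b k) →
  ec ≤ fromℚ K * r
EC≤three-halves-power {f = f} {S} {ec} {b} {r} 1≤S C′ isEC power S≤ =
  let T , E , T²≤ = expectational 1≤S C′
  in ≤ℝ-trans {ec} {fromℚ T} {fromℚ K * r} (EC≤ {ec = ec} E isEC)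
    (eventually-≤⇒≤ (fromℚ T) (fromℚ K * r) (≤-three-halves-power {b} {r} power {λ _ → T}
      (eventually-map (λ k (½≤b , S≤5b) → ½≤b , bound {T} T²≤ (seq b k) ½≤b S≤5b) S≤)))
  where
  bound : ∀ {T} → T ℚ.* T ℚ.≤ + 64 ℚ./ 1 ℚ.* (S ℚ.* S ℚ.* S) →
    ∀ b → ½ ℚ.≤ b → S ℚ.≤ + 5 ℚ./ 1 ℚ.* b → T ℚ.* T ℚ.≤ C ℚ.* (b ℚ.* b ℚ.* b)
  bound T²≤ b ½≤b S≤5b = ℚ.≤-trans T²≤ (ℚ.≤-trans
    (ℚ.*-monoˡ-≤-nonNeg (+ 64 ℚ./ 1) (cube-mono-≤ (0≤p*q (ℚ.nonNegative⁻¹ (+ 5 ℚ./ 1)) 0≤b) S≤5b))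
    (≤-by-difference (0≤p*q (ℚ.nonNegative⁻¹ (+ 192 ℚ./ 1)) (0≤p*q (0≤p*q 0≤b 0≤b) 0≤b))
      (solve 1 (λ b → con (+ 64 ℚ./ 1) :* ((con (+ 5 ℚ./ 1) :* b) :* (con (+ 5 ℚ./ 1) :* b) :* (con (+ 5 ℚ./ 1) :* b)) :+
          con (+ 192 ℚ./ 1) :* (b :* b :* b) := con C :* (b :* b :* b)) refl b)))
    where
    0≤b = ℚ.≤-trans (ℚ.nonNegative⁻¹ ½) ½≤b

-- S ≥ 1 forces fc ≥ 3/4 - 1/4 = 1/2, and then the additive 1/3 in the bound on S is absorbed into a
-- multiple of fc.
FC-scale : ∀ {S fc} → 1ℚ ℚ.≤ S → S ℚ.≤ + 4 ℚ./ 3 ℚ.* (fc ℚ.+ + 1 ℚ./ 4) →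
  ½ ℚ.≤ fc × S ℚ.≤ + 5 ℚ./ 1 ℚ.* fc
FC-scale {S} {fc} 1≤S S≤ = ½≤fc , ℚ.≤-trans S≤
  (≤-by-difference (0≤p+q (0≤p*q (ℚ.nonNegative⁻¹ (+ 11 ℚ./ 3)) (p≤q⇒0≤q-p ½≤fc)) (ℚ.nonNegative⁻¹ (+ 3 ℚ./ 2)))
    (solve 1 (λ x → con (+ 4 ℚ./ 3) :* (x :+ con (+ 1 ℚ./ 4)) :+ (con (+ 11 ℚ./ 3) :* (x :- con ½) :+ con (+ 3 ℚ./ 2))
      := con (+ 5 ℚ./ 1) :* x) refl fc))
  where
  ½≤fc : ½ ℚ.≤ fc
  ½≤fc = ≤-by-difference (0≤p*q (ℚ.nonNegative⁻¹ (+ 3 ℚ./ 4)) (p≤q⇒0≤q-p (ℚ.≤-trans 1≤S S≤)))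
    (solve 1 (λ x → con ½ :+ con (+ 3 ℚ./ 4) :* (con (+ 4 ℚ./ 3) :* (x :+ con (+ 1 ℚ./ 4)) :- con 1ℚ) := x) refl fc)

-- Integrality of d: the only natural number below 1 is 0, which contradicts the hypothesis.
1≤5d⇒1≤d : ∀ d → 1ℚ ℚ.≤ + 5 ℚ./ 1 ℚ.* (+ d ℚ./ 1) → 1ℚ ℚ.≤ + d ℚ./ 1
1≤5d⇒1≤d zero    1≤0 = contradiction 1≤0 (toWitnessFalse {a? = 1ℚ ℚ.≤? 0ℚ} _)
1≤5d⇒1≤d (suc d) _   = /1-mono-≤ {1} {suc d} (ℕ.s≤s ℕ.z≤n)

½≤1 : ½ ℚ.≤ 1ℚ
½≤1 = toWitness {a? = ½ ℚ.≤? 1ℚ} _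

≤-three-halves-power-mono : ∀ {fc d y r} → 1ℚ ℚ.≤ d → fc ≤ fromℚ (+ 5 ℚ./ 1 ℚ.* d) →
  IsThreeHalvesPower fc y → IsThreeHalvesPower (fromℚ d) r → y ≤ fromℚ K * r
≤-three-halves-power-mono {fc} {d} {y} {r} 1≤d fc≤5d (_ , y²≤fc³ , _) power =
  eventually-≤⇒≤ y (fromℚ K * r) (≤-three-halves-power {fromℚ d} {r} power {seq y}
    (eventually-map (λ k (fc≤ , y²≤) → ℚ.≤-trans ½≤1 1≤d , bound (seq fc k) (seq y k) fc≤ y²≤)
      (fc≤5d 1ℚ (ℚ.positive⁻¹ 1ℚ) ⟨×⟩ y²≤fc³ 1ℚ (ℚ.positive⁻¹ 1ℚ))))
  where
  0≤d = ℚ.≤-trans (ℚ.nonNegative⁻¹ 1ℚ) 1≤d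

  d³ = d ℚ.* d ℚ.* d

  bound : ∀ x y → x ℚ.≤ + 5 ℚ./ 1 ℚ.* d ℚ.+ 1ℚ → y ℚ.* y ℚ.≤ x ℚ.* x ℚ.* x ℚ.+ 1ℚ → y ℚ.* y ℚ.≤ C ℚ.* d³
  bound x y x≤ y²≤ = ℚ.≤-trans y²≤ (ℚ.≤-trans
    (ℚ.+-mono-≤ (cube-mono-≤ (0≤p*q (ℚ.nonNegative⁻¹ (+ 6 ℚ./ 1)) 0≤d) x≤6d) 1≤d³)
    -- As d ≥ 1, the additive errors 1 are absorbed: x ≤ 6d and y² ≤ 216d³ + d³, with 8192 - 217 =
    -- 7975 to spare.
    (≤-by-difference (0≤p*q (ℚ.nonNegative⁻¹ (+ 7975 ℚ./ 1)) (0≤p*q (0≤p*q 0≤d 0≤d) 0≤d))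
      (solve 1 (λ d → ((con (+ 6 ℚ./ 1) :* d) :* (con (+ 6 ℚ./ 1) :* d) :* (con (+ 6 ℚ./ 1) :* d) :+ d :* d :* d) :+
          con (+ 7975 ℚ./ 1) :* (d :* d :* d) := con C :* (d :* d :* d)) refl d)))
    where
    x≤6d : x ℚ.≤ + 6 ℚ./ 1 ℚ.* d
    x≤6d = ℚ.≤-trans x≤ (≤-by-difference (p≤q⇒0≤q-p 1≤d)
      (solve 1 (λ d → (con (+ 5 ℚ./ 1) :* d :+ con 1ℚ) :+ (d :- con 1ℚ) := con (+ 6 ℚ./ 1) :* d) refl d))
    1≤d³ : 1ℚ ℚ.≤ d³
    1≤d³ = cube-mono-≤ {1ℚ} 0≤d 1≤d

IsR⇒certificates : ∀ {f : BoolFun n} {d} → IsR f d → Certificates f (+ 5 ℚ./ 1 ℚ.* (+ d ℚ./ 1))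
IsR⇒certificates {f = f} ((A , computes , worstCase≡d) , _) =
  subst (λ d → Certificates f (+ 5 ℚ./ 1 ℚ.* (+ d ℚ./ 1))) worstCase≡d (QueryProbabilities.certificates A computes)

module _ {f : BoolFun n} {x y : Input n} (fy≢fx : f y ≢ f x) where

  EC≤FC^three-halves : ∀ ec fc z → IsEC f ec → IsFC f fc → IsThreeHalvesPower fc z → ec ≤ fromℚ K * z
  EC≤FC^three-halves ec fc z isEC isFC power =
    let S , cert , S≤ = FC⇒certificates {fc = fc} isFC
        1≤ = nonconstant⇒1≤S cert x y fy≢fx
    in EC≤three-halves-power {S = S} {ec} {fc} {z} 1≤ cert isEC power
         (eventually-map (λ k → FC-scale {S} {seq fc k} 1≤) S≤)

  1≤R : ∀ d → Certificates f (+ 5 ℚ./ 1 ℚ.* (+ d ℚ./ 1)) → 1ℚ ℚ.≤ + d ℚ./ 1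
  1≤R d cert = 1≤5d⇒1≤d d (nonconstant⇒1≤S cert x y fy≢fx)

  EC≤R^three-halves : ∀ ec d z → IsEC f ec → IsR f d → IsThreeHalvesPower (fromℕ d) z → ec ≤ fromℚ K * z
  EC≤R^three-halves ec d z isEC isR power =
    EC≤three-halves-power {S = + 5 ℚ./ 1 ℚ.* (+ d ℚ./ 1)} {ec} {fromℕ d} {z}
      (nonconstant⇒1≤S cert x y fy≢fx) cert isEC power (always λ k → ℚ.≤-trans ½≤1 (1≤R d cert) , ℚ.≤-refl)
    where cert = IsR⇒certificates isR

  FC^three-halves≤R^three-halves : ∀ fc d z z′ → IsFC f fc → IsR f d → IsThreeHalvesPower fc z →
    IsThreeHalvesPower (fromℕ d) z′ → z ≤ fromℚ K * z′
  FC^three-halves≤R^three-halves fc d z z′ isFC isR power power′ =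
    ≤-three-halves-power-mono {fc} {+ d ℚ./ 1} {z} {z′}
      (1≤R d cert) (FC≤ {fc = fc} cert isFC) power power′
    where cert = IsR⇒certificates isR

corollary9 : Σ[ K ∈ ℝ ] (0ℝ < K ×
    (∀ (n : ℕ) → 1 ℕ.≤ n → (f : BoolFun n) →
    (∀ ec fc fc³ᐟ² → IsEC f ec → IsFC f fc → IsThreeHalvesPower fc fc³ᐟ² →
    ec ≤ K * fc³ᐟ²) ×
    (∀ ec r r³ᐟ² → IsEC f ec → IsR f r → IsThreeHalvesPower (fromℕ r) r³ᐟ² →
    ec ≤ K * r³ᐟ²) ×
    (∀ fc r fc³ᐟ² r³ᐟ² → IsFC f fc → IsR f r →
    IsThreeHalvesPower fc fc³ᐟ² → IsThreeHalvesPower (fromℕ r) r³ᐟ² →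
    fc³ᐟ² ≤ K * r³ᐟ²)))
corollary9 = fromℚ K , (1ℚ , ℚ.positive⁻¹ 1ℚ , always λ _ → toWitness {a? = 0ℚ ℚ.+ 1ℚ ℚ.≤? K} _) ,
  λ n _ f → bounds f (constant-or-not f)
  where
  bounds : ∀ {n} (f : BoolFun n) → (∀ x y → f y ≡ f x) ⊎ (∃[ x ] ∃[ y ] f y ≢ f x) →
    (∀ ec fc fc³ᐟ² → IsEC f ec → IsFC f fc → IsThreeHalvesPower fc fc³ᐟ² → ec ≤ fromℚ K * fc³ᐟ²) ×
    (∀ ec r r³ᐟ² → IsEC f ec → IsR f r → IsThreeHalvesPower (fromℕ r) r³ᐟ² → ec ≤ fromℚ K * r³ᐟ²) ×
    (∀ fc r fc³ᐟ² r³ᐟ² → IsFC f fc → IsR f r → IsThreeHalvesPower fc fc³ᐟ² →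
      IsThreeHalvesPower (fromℕ r) r³ᐟ² → fc³ᐟ² ≤ fromℚ K * r³ᐟ²)
  -- Zero weights give EC ≤ 0 and FC ≤ 0, hence also FC^{3/2} ≤ 0, while every right-hand side is
  -- nonnegative.
  bounds f (inj₁ constant) =
    (λ ec fc y isEC _ power → ≤ℝ-trans {ec} {0ℝ} {fromℚ K * y} (ec≤0 ec isEC) (0≤K*y {fc} {y} power)) ,
    (λ ec r y isEC _ power → ≤ℝ-trans {ec} {0ℝ} {fromℚ K * y} (ec≤0 ec isEC) (0≤K*y {fromℕ r} {y} power)) ,
    (λ fc r y z isFC _ power power′ → ≤ℝ-trans {y} {0ℝ} {fromℚ K * z}
      (≤-three-halves-power-≤0 {fc} {y} (FC≤ {fc = fc} (constant⇒certificates constant) isFC) power)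
      (0≤K*y {fromℕ r} {z} power′))
    where
    ec≤0 : ∀ ec → IsEC f ec → ec ≤ 0ℝ
    ec≤0 ec = EC≤ {ec = ec} (constant⇒expectational constant)
  bounds f (inj₂ (x , y , fy≢fx)) =
    EC≤FC^three-halves {x = x} {y} fy≢fx , EC≤R^three-halves {x = x} {y} fy≢fx ,
    FC^three-halves≤R^three-halves {x = x} {y} fy≢fx
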